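{- There is a $2$-c.e. set $C\subseteq\omega$ which has an asymptotic density but whose density $\rho(C)$ is not the asymptotic density of any c.e. set or of any co-c.e. set.
   Context: For $X \subseteq \omega=\{0,1,2,\dots\}$ and an integer $m>0$, let $\rho_m(X) = |\{j \in X : j < m\}|/m$. The set $X$ has a (asymptotic) density if $\lim_m \rho_m(X)$ exists, and the density is then $\rho(X) = \lim_m \rho_m(X)$. Sets are identified with their characteristic functions. A set $C \subseteq \omega$ is $2$-c.e. if there is a computable function $g:\omega\times\omega\to\{0,1\}$ such that for all $x$: $g(x,0)=0$, $C(x)=\lim_s g(x,s)$, and $|\{s : g(x,s) \neq g(x,s+1)\}| \leq 2$. Equivalently, $C$ is a difference $A\setminus B$ of two c.e. sets. A set is co-c.e. if its complement in $\omega$ is c.e. -}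

module Defs where

open import Data.Bool.Base using (Bool; true; false; not)
open import Data.Fin.Base using (Fin)
open import Data.Integer.Base using (+_)
open import Data.List.Base using (length; filterᵇ; upTo)
open import Data.List.Membership.Propositional using (_∈_)
open import Data.Nat.Base as ℕ using (ℕ; suc; NonZero)
open import Data.Product.Base using (∃-syntax; _×_)
open import Data.Rational.Base using (ℚ; _/_; _-_; ∣_∣; _≤_; _<_; 0ℚ)
open import Data.Vec.Base using (Vec; []; _∷_; lookup)
open import Data.Vec.Relation.Binary.Pointwise.Inductive using (Pointwise)
open import Function.Bundles using (_⇔_)
open import Function.Base using (_∘_)
open import Relation.Binary.PropositionalEquality.Core using (_≡_; _≢_)

data Code : ℕ → Set where
  zeroᶜ : Code 0
  sucᶜ  : Code 1
  projᶜ : ∀ {n} → Fin n → Code n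
  compᶜ : ∀ {m n} → Code m → Vec (Code n) m → Code n
  precᶜ : ∀ {n} → Code n → Code (2 ℕ.+ n) → Code (suc n)
  minᶜ  : ∀ {n} → Code (suc n) → Code n

infix 4 _[_]⇓_

-- e [ xs ]⇓ y : the μ-recursive partial function coded by e is defined at xs, with
-- value y.  The recursion (or search) variable is the first argument; the
-- step function of precᶜ takes that variable, then the previous value.
data _[_]⇓_ : ∀ {n} → Code n → Vec ℕ n → ℕ → Set where
  zero⇓  : zeroᶜ [ [] ]⇓ 0
  suc⇓   : ∀ {x} → sucᶜ [ x ∷ [] ]⇓ suc x
  proj⇓  : ∀ {n xs} {i : Fin n} → projᶜ i [ xs ]⇓ lookup xs i
  comp⇓  : ∀ {m n xs ys z} {f : Code m} {gs : Vec (Code n) m} →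
           Pointwise (λ g y → g [ xs ]⇓ y) gs ys →
           f [ ys ]⇓ z →
           compᶜ f gs [ xs ]⇓ z
  prec0⇓ : ∀ {n xs y} {f : Code n} {g : Code (2 ℕ.+ n)} →
           f [ xs ]⇓ y →
           precᶜ f g [ 0 ∷ xs ]⇓ y
  precs⇓ : ∀ {n xs k y z} {f : Code n} {g : Code (2 ℕ.+ n)} →
           precᶜ f g [ k ∷ xs ]⇓ y →
           g [ k ∷ y ∷ xs ]⇓ z →
           precᶜ f g [ suc k ∷ xs ]⇓ z
  min⇓   : ∀ {n xs y} {f : Code (suc n)} →
           (∀ {z} → z ℕ.< y → ∃[ v ] f [ z ∷ xs ]⇓ suc v) →
           f [ y ∷ xs ]⇓ 0 →
           minᶜ f [ xs ]⇓ y

-- Characteristic functions.  Given excluded middle, every predicate ℕ → Set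
-- is of this form.
ωSet : Set
ωSet = ℕ → Bool

∁ : ωSet → ωSet
∁ X = not ∘ X

bit : Bool → ℕ
bit false = 0
bit true  = 1

Computable₂ : (ℕ → ℕ → Bool) → Set
Computable₂ g = ∃[ e ] ∀ x s → e [ x ∷ s ∷ [] ]⇓ bit (g x s)

CE : ωSet → Set
CE X = ∃[ e ] ∀ x → X x ≡ true ⇔ (∃[ y ] e [ x ∷ [] ]⇓ y)

CoCE : ωSet → Set
CoCE X = CE (∁ X)

-- The cardinality bound ∣{s ∣ P s}∣ ≤ k, by a covering list of length at most k.
AtMost : ℕ → (ℕ → Set) → Set
AtMost k P = ∃[ xs ] length {A = ℕ} xs ℕ.≤ k × (∀ s → P s → s ∈ xs)

_⟶_ : (ℕ → Bool) → Bool → Set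
h ⟶ b = ∃[ N ] ∀ s → N ℕ.≤ s → h s ≡ b

TwoCE : ωSet → Set
TwoCE C = ∃[ g ] Computable₂ g ×
  (∀ x → g x 0 ≡ false
       × g x ⟶ C x
       × AtMost 2 (λ s → g x s ≢ g x (suc s)))

-- Cauchy reals.  Equality of reals is not needed: HasDensity below depends on
-- a Cauchy sequence only through its limit.
record ℝ : Set where
  field
    seq    : ℕ → ℚ
    cauchy : ∀ ε → 0ℚ < ε →
             ∃[ N ] ∀ m n → N ℕ.≤ m → N ℕ.≤ n → ∣ seq m - seq n ∣ < ε

-- Within q x ε : the real number ∣ q - x ∣ is strictly below ε.  A strict
-- bound on the terms would only give ∣ q - x ∣ ≤ ε in the limit, hence δ.
Within : ℚ → ℝ → ℚ → Set
Within q x ε =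
  ∃[ δ ] δ < ε × ∃[ N ] ∀ n → N ℕ.≤ n → ∣ q - ℝ.seq x n ∣ ≤ δ

ρ : ωSet → (m : ℕ) .{{_ : NonZero m}} → ℚ
ρ X m = + length (filterᵇ X (upTo m)) / m

HasDensity : ωSet → ℝ → Set
HasDensity X r = ∀ ε → 0ℚ < ε →
  ∃[ N ] ∀ m .{{_ : NonZero m}} → N ℕ.≤ m → Within (ρ X m) r ε

{-# OPTIONS --safe #-}

-- Split ω into the columns { x ∣ 3^n exactly divides x + 1 }, of density
-- 2 / 3^(n+1), and let C be eventually constant on each of them.  Then C has
-- density r = Σ 2 z_n / 3^(n+1), where z_n is the value on column n, and p / 3^M
-- ≤ r ≤ (p + 1) / 3^M for some p < 3^M determined by z_0, …, z_(M-1).  Since p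
-- is not computable, a requirement "A does not have density r" receives a
-- block of 3^M columns M + j, one for each possible value j of p.  On column
-- M + j the set C copies whether the density of A below some m > x is less than
-- j / 3^M + 1 / (2 · 3^(M+j)): a c.e. condition on x if ∁ A is c.e., and, with
-- "not greater" for "less", a co-c.e. one if A is c.e., so that C is 2-c.e.  If
-- A had density r, then for j = p column M + j would be full if r is less than
-- the threshold and empty if r is greater.  But the columns M + j with j < p
-- are empty, since p / 3^M ≤ r exceeds their thresholds, and therefore a full
-- column M + p puts r above the threshold, an empty one below.

module Submission where

open import Defs
open import Axiom.ExcludedMiddle using (ExcludedMiddle)
open import Data.Bool.Base using (Bool; true; false; not)
open import Data.Empty using (⊥; ⊥-elim)
open import Data.Fin.Base using (Fin; zero; suc)
open import Data.Integer.Base as ℤ using (+≤+; +<+) renaming (+_ to ⁺_)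
import Data.Integer.Properties as ℤ
open import Data.List.Base as List using (length; filterᵇ; upTo)
import Data.List.Properties as List
open import Data.List.Relation.Unary.Any using (here; there)
open import Data.Nat.Base
open import Data.Nat.Divisibility using (divides)
open import Data.Nat.DivMod
open import Data.Nat.Properties
open import Data.Nat.Tactic.RingSolver using (solve-∀)
open import Data.Product.Base
open import Data.Rational.Base as ℚ using (ℚ; 0ℚ; mkℚ; toℚᵘ)
import Data.Rational.Properties as ℚ
open import Data.Rational.Unnormalised.Base as ℚᵘ using (mkℚᵘ)
import Data.Rational.Unnormalised.Properties as ℚᵘ
open import Data.Sum.Base using (_⊎_; inj₁; inj₂)
open import Data.Unit.Base using (⊤; tt)
open import Data.Vec.Base using (Vec; []; _∷_; lookup)
open import Data.Vec.Relation.Binary.Pointwise.Inductive using (Pointwise; []; _∷_)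
open import Function.Base using (_∘_)
open import Function.Bundles using (_⇔_; mk⇔; Equivalence)
open import Level using (0ℓ)
open import Relation.Binary.Definitions using (tri<; tri≈; tri>)
open import Relation.Binary.PropositionalEquality
open import Relation.Nullary.Decidable.Core using (yes; no; does)
open import Relation.Nullary.Negation.Core using (¬_)

-- Base 3 leaves room for the thresholds. Column n has density 2/3^(n+1), all later columns together
-- 1/3^(n+1). With the earlier columns fixed, emptying or filling column n therefore puts r into one
-- of two intervals separated by a gap of 1/3^(n+1), and the threshold of column M + p is the
-- midpoint of that gap. In base 2 the two intervals would touch; r could equal the threshold, and
-- then the frequencies of A need not stay on either side of it. No finite stage decides how r
-- compares with a threshold. Asking each x only for some m > x lets an element change once after
-- its initial value, while the column as a whole records whether infinitely many m succeed. One
-- computable approximation serves all requirements, so a uniform enumeration of the c.e. sets is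
-- needed. A code is translated into a primitive recursive term that takes a bound on all searches
-- as an extra argument; the terms are numbered and executed by a machine. A single machine step is
-- a fixed computable function of the state, and iterating it is primitive recursion.

private
  variable
    n : ℕ
    f g h k : Vec ℕ n → ℕ

-- Closure properties of the computable functions, and pairing

record Computable {n} (f : Vec ℕ n → ℕ) : Set where
  constructor computable
  field
    code : Code n
    eval : ∀ xs → code [ xs ]⇓ f xs
open Computable

retarget : ∀ {e : Code n} {xs y z} → y ≡ z → e [ xs ]⇓ y → e [ xs ]⇓ z
retarget refl d = d

varᶜ : (i : Fin n) → Computable (λ v → lookup v i)
varᶜ i = computable (projᶜ i) (λ _ → proj⇓)

v₀ : Computable {1 + n} (λ v → lookup v zero)
v₀ = varᶜ zero

v₁ : Computable {2 + n} (λ v → lookup v (suc zero))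
v₁ = varᶜ (suc zero)

v₂ : Computable {3 + n} (λ v → lookup v (suc (suc zero)))
v₂ = varᶜ (suc (suc zero))

v₃ : Computable {4 + n} (λ v → lookup v (suc (suc (suc zero))))
v₃ = varᶜ (suc (suc (suc zero)))

v₄ : Computable {5 + n} (λ v → lookup v (suc (suc (suc (suc zero)))))
v₄ = varᶜ (suc (suc (suc (suc zero))))

lift₁ : (φ : ℕ → ℕ) → Computable {1} (λ v → φ (lookup v zero)) →
        Computable f → Computable (λ v → φ (f v))
lift₁ φ c F = computable (compᶜ (code c) (code F ∷ []))
  (λ v → comp⇓ (eval F v ∷ []) (eval c _))

lift₂ : (φ : ℕ → ℕ → ℕ) →
        Computable {2} (λ v → φ (lookup v zero) (lookup v (suc zero))) →
        Computable f → Computable g → Computable (λ v → φ (f v) (g v))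
lift₂ φ c F G = computable (compᶜ (code c) (code F ∷ code G ∷ []))
  (λ v → comp⇓ (eval F v ∷ eval G v ∷ []) (eval c _))

lift₃ : (φ : ℕ → ℕ → ℕ → ℕ) →
        Computable {3} (λ v → φ (lookup v zero) (lookup v (suc zero))
                                (lookup v (suc (suc zero)))) →
        Computable f → Computable g → Computable h →
        Computable (λ v → φ (f v) (g v) (h v))
lift₃ φ c F G H = computable (compᶜ (code c) (code F ∷ code G ∷ code H ∷ []))
  (λ v → comp⇓ (eval F v ∷ eval G v ∷ eval H v ∷ []) (eval c _))

lift₄ : (φ : ℕ → ℕ → ℕ → ℕ → ℕ) →
        Computable {4} (λ v → φ (lookup v zero) (lookup v (suc zero))
          (lookup v (suc (suc zero))) (lookup v (suc (suc (suc zero))))) →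
        Computable f → Computable g → Computable h → Computable k →
        Computable (λ v → φ (f v) (g v) (h v) (k v))
lift₄ φ c F G H K =
  computable (compᶜ (code c) (code F ∷ code G ∷ code H ∷ code K ∷ []))
    (λ v → comp⇓ (eval F v ∷ eval G v ∷ eval H v ∷ eval K v ∷ []) (eval c _))

recᶜ : (f : Vec ℕ (suc n) → ℕ) → Computable g → Computable h →
       (∀ v → g v ≡ f (0 ∷ v)) →
       (∀ i v → h (i ∷ f (i ∷ v) ∷ v) ≡ f (suc i ∷ v)) →
       Computable f
recᶜ f G H f0 fs = computable (precᶜ (code G) (code H)) λ { (i ∷ v) → go i v }
  where
  go : ∀ i v → precᶜ (code G) (code H) [ i ∷ v ]⇓ f (i ∷ v)
  go zero v = prec0⇓ (retarget (f0 v) (eval G v))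
  go (suc i) v = precs⇓ (go i v) (retarget (fs i v) (eval H _))

minimizeᶜ : (f : Vec ℕ n → ℕ) → Computable g →
            (∀ v → g (f v ∷ v) ≡ 0) → (∀ v {i} → i < f v → g (i ∷ v) ≢ 0) →
            Computable f
minimizeᶜ f G root least = computable (minᶜ (code G)) λ v →
  min⇓ (λ {i} i<f → positive (least v i<f) (eval G (i ∷ v)))
       (retarget (root v) (eval G _))
  where
  positive : ∀ {e : Code n} {xs y} → y ≢ 0 → e [ xs ]⇓ y → ∃[ u ] e [ xs ]⇓ suc u
  positive {y = zero}  y≢0 _ = ⊥-elim (y≢0 refl)
  positive {y = suc u} _   d = u , d

sucᶜ′ : Computable f → Computable (λ v → suc (f v))
sucᶜ′ = lift₁ suc (computable sucᶜ λ { (_ ∷ []) → suc⇓ })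

litᶜ : ∀ a → Computable {n} (λ _ → a)
litᶜ zero = computable (compᶜ zeroᶜ []) λ _ → comp⇓ [] zero⇓
litᶜ (suc a) = sucᶜ′ (litᶜ a)

infixl 6 _+ᶜ_ _∸ᶜ_
infixl 7 _*ᶜ_
infixr 8 _^ᶜ_

_+ᶜ_ : Computable f → Computable g → Computable (λ v → f v + g v)
_+ᶜ_ = lift₂ _+_ (recᶜ _ v₀ (sucᶜ′ v₁) (λ _ → refl) (λ _ _ → refl))

_*ᶜ_ : Computable f → Computable g → Computable (λ v → f v * g v)
_*ᶜ_ = lift₂ _*_ (recᶜ _ (litᶜ 0) (v₂ +ᶜ v₁) (λ _ → refl) (λ _ _ → refl))

_^ᶜ_ : Computable f → Computable g → Computable (λ v → f v ^ g v)
A ^ᶜ B = lift₂ (λ b a → a ^ b)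
  (recᶜ _ (litᶜ 1) (v₂ *ᶜ v₁) (λ _ → refl) (λ _ _ → refl)) B A

predᶜ : Computable f → Computable (λ v → pred (f v))
predᶜ = lift₁ pred (recᶜ _ (litᶜ 0) v₀ (λ _ → refl) (λ _ _ → refl))

_∸ᶜ_ : Computable f → Computable g → Computable (λ v → f v ∸ g v)
A ∸ᶜ B = lift₂ (λ b a → a ∸ b)
  (recᶜ _ v₀ (predᶜ v₁) (λ _ → refl) (λ i v → pred[m∸n]≡m∸[1+n] (lookup v zero) i)) B A

ifz : ℕ → ℕ → ℕ → ℕ
ifz zero    a b = a
ifz (suc _) a b = b

ifzᶜ : Computable f → Computable g → Computable h →
       Computable (λ v → ifz (f v) (g v) (h v))
ifzᶜ = lift₃ ifz (recᶜ _ v₀ v₃ (λ _ → refl) (λ _ _ → refl))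

-- Cantor's pairing; diag n is the antidiagonal containing n.
tri : ℕ → ℕ
tri zero    = 0
tri (suc k) = suc k + tri k

triᶜ : Computable f → Computable (λ v → tri (f v))
triᶜ = lift₁ tri (recᶜ _ (litᶜ 0) (sucᶜ′ v₀ +ᶜ v₁) (λ _ → refl) (λ _ _ → refl))

diag : ℕ → ℕ
diag zero    = 0
diag (suc n) = ifz (tri (suc (diag n)) ∸ suc n) (suc (diag n)) (diag n)

diagᶜ : Computable f → Computable (λ v → diag (f v))
diagᶜ = lift₁ diag (recᶜ _ (litᶜ 0)
  (ifzᶜ (triᶜ (sucᶜ′ v₁) ∸ᶜ sucᶜ′ v₀) (sucᶜ′ v₁) v₁) (λ _ → refl) (λ _ _ → refl))

-- Antidiagonal `k` consists of the k + 1 numbers from `tri k` on, so `diag` moves on exactly when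
-- the next triangular number is reached.
diag-tri : ∀ k j → j ≤ k → diag (j + tri k) ≡ k
diag-tri zero    zero    _ = refl
diag-tri (suc k) zero    _
  rewrite diag-tri k k ≤-refl | n∸n≡0 (k + tri k) = refl
diag-tri k       (suc j) j<k
  rewrite diag-tri k j (<⇒≤ j<k)
  = nonzero
  where
  nonzero : ifz ((k + tri k) ∸ (j + tri k)) (suc k) k ≡ k
  nonzero with (k + tri k) ∸ (j + tri k) in eq
  ... | suc _ = refl
  ... | zero  = ⊥-elim (<⇒≱ (+-monoˡ-< (tri k) j<k) (m∸n≡0⇒m≤n eq))

opaque
  pair : ℕ → ℕ → ℕ
  pair a b = b + tri (a + b)

  snd : ℕ → ℕ
  snd n = n ∸ tri (diag n)

  fst : ℕ → ℕ
  fst n = diag n ∸ snd n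

  pairᶜ : Computable f → Computable g → Computable (λ v → pair (f v) (g v))
  pairᶜ A B = B +ᶜ triᶜ (A +ᶜ B)

  sndᶜ : Computable f → Computable (λ v → snd (f v))
  sndᶜ A = A ∸ᶜ triᶜ (diagᶜ A)

  fstᶜ : Computable f → Computable (λ v → fst (f v))
  fstᶜ A = diagᶜ A ∸ᶜ sndᶜ A

  snd-pair : ∀ a b → snd (pair a b) ≡ b
  snd-pair a b rewrite diag-tri (a + b) b (m≤n+m b a) = m+n∸n≡m b (tri (a + b))

  fst-pair : ∀ a b → fst (pair a b) ≡ a
  fst-pair a b rewrite snd-pair a b | diag-tri (a + b) b (m≤n+m b a) = m+n∸n≡m a b

  fst-0 : fst 0 ≡ 0
  fst-0 = refl

-- A universal machine for primitive recursion

infixr 9 _∘ₚ_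

-- Primitive recursion on pairs; the last two constructors only arise as
-- continuations in the machine below.
data PR : Set where
  zeroₚ sucₚ fstₚ sndₚ idₚ : PR
  _∘ₚ_ forkₚ recₚ : PR → PR → PR
  thenₚ   : PR → ℕ → PR
  attachₚ : ℕ → PR

iter : (ℕ → ℕ) → (ℕ → ℕ) → ℕ → ℕ → ℕ
iter f g zero    a = f a
iter f g (suc k) a = g (pair (pair k a) (iter f g k a))

⟦_⟧ : PR → ℕ → ℕ
⟦ zeroₚ ⟧     x = 0
⟦ sucₚ ⟧      x = suc x
⟦ fstₚ ⟧      x = fst x
⟦ sndₚ ⟧      x = snd x
⟦ idₚ ⟧       x = x
⟦ p ∘ₚ q ⟧    x = ⟦ p ⟧ (⟦ q ⟧ x)
⟦ forkₚ p q ⟧ x = pair (⟦ p ⟧ x) (⟦ q ⟧ x)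
⟦ recₚ p q ⟧  x = iter ⟦ p ⟧ ⟦ q ⟧ (fst x) (snd x)
⟦ thenₚ p a ⟧ x = pair x (⟦ p ⟧ a)
⟦ attachₚ a ⟧ x = pair a x

#_ : PR → ℕ
# zeroₚ     = pair 1 0
# sucₚ      = pair 2 0
# fstₚ      = pair 3 0
# sndₚ      = pair 4 0
# idₚ       = pair 5 0
# (p ∘ₚ q)  = pair 6 (pair (# p) (# q))
# forkₚ p q = pair 7 (pair (# p) (# q))
# recₚ p q  = pair 8 (pair (# p) (# q))
# thenₚ p a = pair 9 (pair (# p) a)
# attachₚ a = pair 10 (pair a 0)

-- A state pairs a stack of instructions with the current value.  The empty
-- stack is 0; its top instruction then has tag 0, which halts.
exec : ℕ → ℕ → ℕ → ℕ → ℕ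
exec t d s x =
  ifz t       (pair 0 x) (
  ifz (t ∸ 1) (pair s 0) (
  ifz (t ∸ 2) (pair s (suc x)) (
  ifz (t ∸ 3) (pair s (fst x)) (
  ifz (t ∸ 4) (pair s (snd x)) (
  ifz (t ∸ 5) (pair s x) (
  ifz (t ∸ 6) (pair (pair (snd d) (pair (fst d) s)) x) (
  ifz (t ∸ 7) (pair (pair (fst d) (pair (pair 9 (pair (snd d) x)) s)) x) (
  ifz (t ∸ 8)
    (ifz (fst x)
      (pair (pair (fst d) s) (snd x))
      (pair (pair (pair 7 (pair (pair 5 0) (pair 8 d))) (pair (snd d) s))
            (pair (pred (fst x)) (snd x)))) (
  ifz (t ∸ 9) (pair (pair (fst d) (pair (pair 10 (pair x 0)) s)) (snd d))
    (pair s (pair (fst d) x)))))))))))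

execᶜ : ∀ {f g h k : Vec ℕ n → ℕ} → Computable f → Computable g →
        Computable h → Computable k → Computable (λ v → exec (f v) (g v) (h v) (k v))
execᶜ = lift₄ exec
  (ifzᶜ t          (pairᶜ (litᶜ 0) x) (
   ifzᶜ (t ∸ᶜ litᶜ 1) (pairᶜ s (litᶜ 0)) (
   ifzᶜ (t ∸ᶜ litᶜ 2) (pairᶜ s (sucᶜ′ x)) (
   ifzᶜ (t ∸ᶜ litᶜ 3) (pairᶜ s (fstᶜ x)) (
   ifzᶜ (t ∸ᶜ litᶜ 4) (pairᶜ s (sndᶜ x)) (
   ifzᶜ (t ∸ᶜ litᶜ 5) (pairᶜ s x) (
   ifzᶜ (t ∸ᶜ litᶜ 6) (pairᶜ (pairᶜ (sndᶜ d) (pairᶜ (fstᶜ d) s)) x) (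
   ifzᶜ (t ∸ᶜ litᶜ 7) (pairᶜ (pairᶜ (fstᶜ d)
     (pairᶜ (pairᶜ (litᶜ 9) (pairᶜ (sndᶜ d) x)) s)) x) (
   ifzᶜ (t ∸ᶜ litᶜ 8)
     (ifzᶜ (fstᶜ x)
       (pairᶜ (pairᶜ (fstᶜ d) s) (sndᶜ x))
       (pairᶜ (pairᶜ (pairᶜ (litᶜ 7) (pairᶜ (pairᶜ (litᶜ 5) (litᶜ 0)) (pairᶜ (litᶜ 8) d)))
                     (pairᶜ (sndᶜ d) s))
              (pairᶜ (predᶜ (fstᶜ x)) (sndᶜ x)))) (
   ifzᶜ (t ∸ᶜ litᶜ 9)
     (pairᶜ (pairᶜ (fstᶜ d) (pairᶜ (pairᶜ (litᶜ 10) (pairᶜ x (litᶜ 0))) s)) (sndᶜ d))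
     (pairᶜ s (pairᶜ (fstᶜ d) x))))))))))))
  where
  t : Computable {4} _
  t = v₀
  d : Computable {4} _
  d = v₁
  s : Computable {4} _
  s = v₂
  x : Computable {4} _
  x = v₃

step : ℕ → ℕ
step m = exec (fst (fst (fst m))) (snd (fst (fst m))) (snd (fst m)) (snd m)

run : ℕ → ℕ → ℕ
run zero    m = m
run (suc c) m = step (run c m)

runᶜ : ∀ {f g : Vec ℕ n → ℕ} → Computable f → Computable g →
       Computable (λ v → run (f v) (g v))
runᶜ = lift₂ run (recᶜ _ v₀
  (execᶜ (fstᶜ (fstᶜ (fstᶜ v₁))) (sndᶜ (fstᶜ (fstᶜ v₁))) (sndᶜ (fstᶜ v₁)) (sndᶜ v₁))
  (λ _ → refl) (λ _ _ → refl))

run-+ : ∀ c d m → run (c + d) m ≡ run c (run d m)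
run-+ zero    d m = refl
run-+ (suc c) d m = cong step (run-+ c d m)

infix 4 _↝_

_↝_ : ℕ → ℕ → Set
m ↝ m′ = ∃[ c ] run c m ≡ m′

infixr 5 _↝∘_

_↝∘_ : ∀ {m m′ m″} → m ↝ m′ → m′ ↝ m″ → m ↝ m″
(c , refl) ↝∘ (d , refl) = d + c , run-+ d c _

step-pair : ∀ t d s x → step (pair (pair (pair t d) s) x) ≡ exec t d s x
step-pair t d s x
  rewrite fst-pair (pair (pair t d) s) x | snd-pair (pair (pair t d) s) x
        | fst-pair (pair t d) s | snd-pair (pair t d) s
        | fst-pair t d | snd-pair t d = refl

one-step : ∀ t d s x {m} → exec t d s x ≡ m → pair (pair (pair t d) s) x ↝ m
one-step t d s x eq = 1 , trans (step-pair t d s x) eq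

Simulates : PR → Set
Simulates p = ∀ s x → pair (pair (# p) s) x ↝ pair s (⟦ p ⟧ x)

simulate-attach : ∀ a → Simulates (attachₚ a)
simulate-attach a s x = one-step 10 (pair a 0) s x
  (cong (λ a′ → pair s (pair a′ x)) (fst-pair _ _))

simulate-then : ∀ {p} a → Simulates p → Simulates (thenₚ p a)
simulate-then {p} a sim s x =
  one-step 9 (pair (# p) a) s x
    (cong₂ (λ i b → pair (pair i (pair (pair 10 (pair x 0)) s)) b)
      (fst-pair _ _) (snd-pair _ _))
  ↝∘ sim (pair (# attachₚ x) s) a ↝∘ simulate-attach x s _

-- A count `suc k` is reduced to `k` by executing `forkₚ idₚ (recₚ p q)` at `pair k a`: its value is
-- exactly the argument that `iter` hands to `q`. Since the same `recₚ p q` is executed again, the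
-- induction is on the count and not on the term.
simulate-rec : ∀ {p q} → Simulates p → Simulates q → Simulates (recₚ p q)
simulate-rec {p} {q} simp simq s x = loop (fst x) (snd x) s x refl refl
  where
  d : ℕ
  d = pair (# p) (# q)

  loop : ∀ k a s x → fst x ≡ k → snd x ≡ a →
         pair (pair (pair 8 d) s) x ↝ pair s (iter ⟦ p ⟧ ⟦ q ⟧ k a)
  loop zero a s x fx sx = one-step 8 d s x first ↝∘ simp s a
    where
    first : exec 8 d s x ≡ pair (pair (# p) s) a
    first rewrite fx | sx | fst-pair (# p) (# q) = refl
  loop (suc k) a s x fx sx =
    one-step 8 d s x first
    ↝∘ one-step 7 (pair (# idₚ) (pair 8 d)) s′ (pair k a)
         (cong₂ (λ i b → pair (pair i (pair (pair 9 (pair b (pair k a))) s′)) (pair k a))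
           (fst-pair _ _) (snd-pair _ _))
    ↝∘ one-step 5 0 (pair (pair 9 (pair (pair 8 d) (pair k a))) s′) (pair k a) refl
    ↝∘ one-step 9 (pair (pair 8 d) (pair k a)) s′ (pair k a)
         (cong₂ (λ i b → pair (pair i (pair (# attachₚ (pair k a)) s′)) b)
           (fst-pair _ _) (snd-pair _ _))
    ↝∘ loop k a (pair (# attachₚ (pair k a)) s′) (pair k a) (fst-pair k a) (snd-pair k a)
    ↝∘ simulate-attach (pair k a) s′ _
    ↝∘ simq s _
    where
    s′ : ℕ
    s′ = pair (# q) s

    first : exec 8 d s x ≡ pair (pair (pair 7 (pair (pair 5 0) (pair 8 d))) s′) (pair k a)
    first rewrite fx | sx | snd-pair (# p) (# q) = refl

simulate : ∀ p → Simulates p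
simulate zeroₚ s x = one-step 1 0 s x refl
simulate sucₚ s x = one-step 2 0 s x refl
simulate fstₚ s x = one-step 3 0 s x refl
simulate sndₚ s x = one-step 4 0 s x refl
simulate idₚ s x = one-step 5 0 s x refl
simulate (p ∘ₚ q) s x =
  one-step 6 (pair (# p) (# q)) s x
    (cong₂ (λ a b → pair (pair b (pair a s)) x) (fst-pair _ _) (snd-pair _ _))
  ↝∘ simulate q (pair (# p) s) x ↝∘ simulate p s _
simulate (forkₚ p q) s x =
  one-step 7 (pair (# p) (# q)) s x
    (cong₂ (λ a b → pair (pair a (pair (pair 9 (pair b x)) s)) x)
      (fst-pair _ _) (snd-pair _ _))
  ↝∘ simulate p (pair (# thenₚ q x) s) x ↝∘ simulate-then {q} x (simulate q) s _
simulate (recₚ p q)  = simulate-rec {p} {q} (simulate p) (simulate q)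
simulate (thenₚ p a) = simulate-then {p} a (simulate p)
simulate (attachₚ a) = simulate-attach a

halted : ∀ c m → fst m ≡ 0 → fst (run c m) ≡ 0 × snd (run c m) ≡ snd m
halted zero    m fm = fm , refl
halted (suc c) m fm with run c m | halted c m fm
... | m′ | fm′ , sm′ = fst≡ , trans snd≡ sm′
  where
  fst≡ : fst (step m′) ≡ 0
  fst≡ rewrite fm′ | fst-0 | fst-0 = fst-pair 0 _
  snd≡ : snd (step m′) ≡ snd m′
  snd≡ rewrite fm′ | fst-0 | fst-0 = snd-pair 0 _

output : ℕ → ℕ
output m = ifz (fst m) (snd m) 0

initial : ℕ → ℕ → ℕ
initial a x = pair (pair a 0) x

-- Both `c` steps and the number of steps from `simulate` lead to halted states, and halted states
-- keep their value; comparing them after the sum of both numbers gives the result. The output must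
-- be positive because 0 is also the output of a state that has not halted.
output-sound : ∀ p x c {y} → output (run c (initial (# p) x)) ≡ suc y → ⟦ p ⟧ x ≡ suc y
output-sound p x c {y} eq with run c (initial (# p) x) in eqr
... | m with fst m in fm
... | zero with simulate p 0 x
...   | d , eqd = begin
  ⟦ p ⟧ x                              ≡⟨ snd-pair 0 _ ⟨
  snd (pair 0 (⟦ p ⟧ x))               ≡⟨ proj₂ (halted c _ (fst-pair 0 _)) ⟨
  snd (run c (pair 0 (⟦ p ⟧ x)))       ≡⟨ cong (λ z → snd (run c z)) eqd ⟨
  snd (run c (run d (initial (# p) x)))  ≡⟨ cong snd (run-+ c d _) ⟨
  snd (run (c + d) (initial (# p) x))    ≡⟨ cong (λ z → snd (run z (initial (# p) x)))
                                              (+-comm c d) ⟩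
  snd (run (d + c) (initial (# p) x))    ≡⟨ cong snd (run-+ d c _) ⟩
  snd (run d (run c (initial (# p) x)))  ≡⟨ cong (λ z → snd (run d z)) eqr ⟩
  snd (run d m)                        ≡⟨ proj₂ (halted d m fm) ⟩
  snd m                                ≡⟨ eq ⟩
  suc y                                ∎
  where open ≡-Reasoning

output-complete : ∀ p x → ∃[ c ] output (run c (initial (# p) x)) ≡ ⟦ p ⟧ x
output-complete p x with simulate p 0 x
... | c , eq = c , trans (cong output eq) out
  where
  out : output (pair 0 (⟦ p ⟧ x)) ≡ ⟦ p ⟧ x
  out rewrite fst-pair 0 (⟦ p ⟧ x) = snd-pair 0 _

-- Evaluation of μ-recursive codes with bounded searches

tuple : Vec ℕ n → ℕ
tuple []       = 0
tuple (x ∷ xs) = pair x (tuple xs)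

-- A case distinction as a recursion whose step ignores the previous value and applies `q` to the
-- saved argument.
ifzₚ : PR → PR → PR → PR
ifzₚ c p q = recₚ p (q ∘ₚ sndₚ ∘ₚ fstₚ) ∘ₚ forkₚ c idₚ

ifzₚ-eq : ∀ c p q x → ⟦ ifzₚ c p q ⟧ x ≡ ifz (⟦ c ⟧ x) (⟦ p ⟧ x) (⟦ q ⟧ x)
ifzₚ-eq c p q x rewrite fst-pair (⟦ c ⟧ x) x | snd-pair (⟦ c ⟧ x) x with ⟦ c ⟧ x
... | zero = refl
... | suc k rewrite fst-pair (pair k x) (iter ⟦ p ⟧ (λ y → ⟦ q ⟧ (snd (fst y))) k x)
                  | snd-pair k x = refl

predₚ : PR
predₚ = recₚ zeroₚ (fstₚ ∘ₚ fstₚ) ∘ₚ forkₚ idₚ idₚ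

predₚ-eq : ∀ x → ⟦ predₚ ⟧ x ≡ pred x
predₚ-eq x rewrite fst-pair x x | snd-pair x x with x
... | zero = refl
... | suc k rewrite fst-pair (pair k (suc k))
                      (iter (λ _ → 0) (λ y → fst (fst y)) k (suc k)) = fst-pair k _

-- Partial values are coded by 0 (undefined) and suc y (the value y).
bindₚ : PR → PR → PR
bindₚ p q = ifzₚ p zeroₚ (q ∘ₚ forkₚ (predₚ ∘ₚ p) idₚ)

bind-suc : ∀ p q x {y} → ⟦ p ⟧ x ≡ suc y → ⟦ bindₚ p q ⟧ x ≡ ⟦ q ⟧ (pair y x)
bind-suc p q x {y} eq = trans (ifzₚ-eq p zeroₚ (q ∘ₚ forkₚ (predₚ ∘ₚ p) idₚ) x) body
  where
  body : ifz (⟦ p ⟧ x) 0 (⟦ q ⟧ (pair (⟦ predₚ ⟧ (⟦ p ⟧ x)) x)) ≡ ⟦ q ⟧ (pair y x)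
  body rewrite eq = cong (λ z → ⟦ q ⟧ (pair z x)) (predₚ-eq (suc y))

bind-inv : ∀ p q x {z} → ⟦ bindₚ p q ⟧ x ≡ suc z →
           ∃[ y ] ⟦ p ⟧ x ≡ suc y × ⟦ q ⟧ (pair y x) ≡ suc z
bind-inv p q x {z} eq = go (⟦ p ⟧ x) refl
  where
  go : ∀ r → ⟦ p ⟧ x ≡ r → ∃[ y ] ⟦ p ⟧ x ≡ suc y × ⟦ q ⟧ (pair y x) ≡ suc z
  go (suc y) eqp = y , eqp , trans (sym (bind-suc p q x eqp)) eq
  go zero    eqp with trans (sym eq) (trans
    (ifzₚ-eq p zeroₚ (q ∘ₚ forkₚ (predₚ ∘ₚ p) idₚ) x)
    (cong (λ r → ifz r 0 (⟦ q ⟧ (pair (⟦ predₚ ⟧ (⟦ p ⟧ x)) x))) eqp))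
  ... | ()

nthₚ : Fin n → PR
nthₚ zero    = fstₚ
nthₚ (suc i) = nthₚ i ∘ₚ sndₚ

nth-eq : ∀ (i : Fin n) xs → ⟦ nthₚ i ⟧ (tuple xs) ≡ lookup xs i
nth-eq zero    (x ∷ xs) = fst-pair _ _
nth-eq (suc i) (x ∷ xs) = trans (cong ⟦ nthₚ i ⟧ (snd-pair _ _)) (nth-eq i xs)

compArgs : PR
compArgs = forkₚ (fstₚ ∘ₚ sndₚ) fstₚ

compArgs-eq : ∀ y w xs → ⟦ compArgs ⟧ (pair y (pair w xs)) ≡ pair w y
compArgs-eq y w xs
  rewrite fst-pair y (pair w xs) | snd-pair y (pair w xs) | fst-pair w xs = refl

consₚ : PR
consₚ = sucₚ ∘ₚ compArgs

recArgs : PR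
recArgs = forkₚ (fstₚ ∘ₚ sndₚ) (forkₚ fstₚ (sndₚ ∘ₚ sndₚ))

recArgs-eq : ∀ w k xs → ⟦ recArgs ⟧ (pair w (pair k xs)) ≡ pair k (pair w xs)
recArgs-eq w k xs rewrite snd-pair w (pair k xs) | fst-pair w (pair k xs)
  | fst-pair k xs | snd-pair k xs = refl

stepArgs : PR
stepArgs = forkₚ (fstₚ ∘ₚ sndₚ ∘ₚ fstₚ ∘ₚ sndₚ)
  (forkₚ (fstₚ ∘ₚ fstₚ ∘ₚ sndₚ) (forkₚ fstₚ (sndₚ ∘ₚ sndₚ ∘ₚ fstₚ ∘ₚ sndₚ)))

stepArgs-eq : ∀ y k w xs r →
  ⟦ stepArgs ⟧ (pair y (pair (pair k (pair w xs)) r)) ≡ pair w (pair k (pair y xs))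
stepArgs-eq y k w xs r
  rewrite fst-pair y (pair (pair k (pair w xs)) r)
        | snd-pair y (pair (pair k (pair w xs)) r)
        | fst-pair (pair k (pair w xs)) r
        | fst-pair k (pair w xs) | snd-pair k (pair w xs)
        | fst-pair w xs | snd-pair w xs = refl

minArgs : PR
minArgs = forkₚ (fstₚ ∘ₚ sndₚ ∘ₚ fstₚ) (forkₚ (fstₚ ∘ₚ fstₚ) (sndₚ ∘ₚ sndₚ ∘ₚ fstₚ))

minArgs-eq : ∀ k w xs r →
  ⟦ minArgs ⟧ (pair (pair k (pair w xs)) r) ≡ pair w (pair k xs)
minArgs-eq k w xs r
  rewrite fst-pair (pair k (pair w xs)) r
        | fst-pair k (pair w xs) | snd-pair k (pair w xs)
        | fst-pair w xs | snd-pair w xs = refl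

oneₚ : PR
oneₚ = sucₚ ∘ₚ zeroₚ

-- The state of a search is 0 after an undefined value, 1 while it runs and
-- 2 + k once the root k is found.
searchStep : PR → PR
searchStep p = ifzₚ (predₚ ∘ₚ sndₚ)
  (ifzₚ sndₚ zeroₚ
    (bindₚ (p ∘ₚ minArgs)
      (ifzₚ fstₚ (sucₚ ∘ₚ sucₚ ∘ₚ fstₚ ∘ₚ fstₚ ∘ₚ sndₚ) oneₚ)))
  sndₚ

mutual
  -- The argument is pair w (tuple xs), where w bounds all searches.
  bounded : Code n → PR
  bounded zeroᶜ        = oneₚ
  bounded sucᶜ         = sucₚ ∘ₚ sucₚ ∘ₚ fstₚ ∘ₚ sndₚ
  bounded (projᶜ i)    = sucₚ ∘ₚ nthₚ i ∘ₚ sndₚ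
  bounded (compᶜ f gs) = bindₚ (boundeds gs) (bounded f ∘ₚ compArgs)
  bounded (precᶜ f g)  =
    recₚ (bounded f) (bindₚ sndₚ (bounded g ∘ₚ stepArgs)) ∘ₚ recArgs
  bounded (minᶜ f)     = predₚ ∘ₚ recₚ oneₚ (searchStep (bounded f)) ∘ₚ forkₚ fstₚ idₚ

  boundeds : ∀ {m} → Vec (Code n) m → PR
  boundeds []       = oneₚ
  boundeds (g ∷ gs) = bindₚ (bounded g) (bindₚ (boundeds gs ∘ₚ sndₚ) consₚ)

input : ℕ → Vec ℕ n → ℕ
input w xs = pair w (tuple xs)

cons-eq : ∀ ys y v → ⟦ consₚ ⟧ (pair ys (pair y v)) ≡ suc (pair y ys)
cons-eq ys y v = cong suc (compArgs-eq ys y v)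

module Search (p : PR) (w : ℕ) (xs : Vec ℕ n) where

  val : ℕ → ℕ
  val k = ⟦ p ⟧ (input w (k ∷ xs))

  state : ℕ → ℕ
  state k = iter ⟦ oneₚ ⟧ ⟦ searchStep p ⟧ k (input w xs)

  next : ℕ → ℕ → ℕ
  next k r = ⟦ searchStep p ⟧ (pair (pair k (input w xs)) r)

  inner outer : PR
  inner = ifzₚ fstₚ (sucₚ ∘ₚ sucₚ ∘ₚ fstₚ ∘ₚ fstₚ ∘ₚ sndₚ) oneₚ
  outer = bindₚ (p ∘ₚ minArgs) inner

  next-eq : ∀ k r → next k r ≡
    ifz (pred r) (ifz r 0 (⟦ outer ⟧ (pair (pair k (input w xs)) r))) r
  next-eq k r
    rewrite ifzₚ-eq (predₚ ∘ₚ sndₚ) (ifzₚ sndₚ zeroₚ outer) sndₚ (pair (pair k (input w xs)) r)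
          | ifzₚ-eq sndₚ zeroₚ outer (pair (pair k (input w xs)) r)
          | snd-pair (pair k (input w xs)) r
          | predₚ-eq r = refl

  inner-eq : ∀ u k v r → ⟦ inner ⟧ (pair u (pair (pair k v) r)) ≡ ifz u (suc (suc k)) 1
  inner-eq u k v r
    rewrite ifzₚ-eq fstₚ (sucₚ ∘ₚ sucₚ ∘ₚ fstₚ ∘ₚ fstₚ ∘ₚ sndₚ) oneₚ (pair u (pair (pair k v) r))
          | fst-pair u (pair (pair k v) r) | snd-pair u (pair (pair k v) r)
          | fst-pair (pair k v) r | fst-pair k v = refl

  val-eq : ∀ k r → ⟦ p ∘ₚ minArgs ⟧ (pair (pair k (input w xs)) r) ≡ val k
  val-eq k r = cong ⟦ p ⟧ (minArgs-eq k w (tuple xs) r)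

  next-found : ∀ k z → next k (2 + z) ≡ 2 + z
  next-found k z = next-eq k (2 + z)

  next-running : ∀ k {u} → val k ≡ suc u → next k 1 ≡ ifz u (suc (suc k)) 1
  next-running k eq = trans (next-eq k 1) (trans
    (bind-suc (p ∘ₚ minArgs) inner _ (trans (val-eq k 1) eq)) (inner-eq _ k _ 1))

  next-inv : ∀ k {y} → next k 1 ≡ suc y → ∃[ u ] val k ≡ suc u × ifz u (suc (suc k)) 1 ≡ suc y
  next-inv k eq with bind-inv (p ∘ₚ minArgs) inner _ (trans (sym (next-eq k 1)) eq)
  ... | u , valk , innerk =
    u , trans (sym (val-eq k 1)) valk , trans (sym (inner-eq u k _ 1)) innerk

  -- `predₚ` sends the states 0 and 1 to "undefined" and the state `2 + k` to `suc k`, which codes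
  -- the value `k`. The bound `w` is the number of search steps, so only roots below `w` are found.
  bounded-min : ⟦ predₚ ∘ₚ recₚ oneₚ (searchStep p) ∘ₚ forkₚ fstₚ idₚ ⟧ (input w xs)
                ≡ pred (state w)
  bounded-min rewrite predₚ-eq (⟦ recₚ oneₚ (searchStep p) ∘ₚ forkₚ fstₚ idₚ ⟧ (input w xs))
    | fst-pair w (tuple xs)
    | fst-pair w (input w xs) | snd-pair w (input w xs) = refl

  Positive : ℕ → Set
  Positive k = ∀ {i} → i < k → ∃[ u ] val i ≡ 2 + u

  -- The invariant of the search after `k` steps. As values are coded with a shift by one, `2 + u`
  -- stands for a positive value and 1 for a root.
  Meaning : ℕ → ℕ → Set
  Meaning k zero          = ⊤
  Meaning k (suc zero)    = Positive k
  Meaning k (suc (suc z)) = Positive z × val z ≡ 1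

  meaning : ∀ k → Meaning k (state k)
  meaning zero ()
  meaning (suc k) with state k | meaning k
  ... | zero | m rewrite next-eq k 0 = tt
  ... | suc (suc z) | m rewrite next-found k z = m
  ... | suc zero | m with next k 1 in eq
  ...   | zero = tt
  ...   | suc y with next-inv k eq
  ...     | zero , valk , refl = m , valk
  ...     | suc u , valk , refl = extend
    where
    extend : Positive (suc k)
    extend {i} i<1+k with m≤n⇒m<n∨m≡n (s≤s⁻¹ i<1+k)
    ... | inj₁ i<k = m i<k
    ... | inj₂ refl = u , valk

  search-sound : ∀ {y} → pred (state w) ≡ suc y → Positive y × val y ≡ 1
  search-sound eq with state w | meaning w
  search-sound refl | suc (suc y) | m = m

  module Root {y} (pos : Positive y) (root : val y ≡ 1) where

    running : ∀ k → k ≤ y → state k ≡ 1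
    running zero    _ = refl
    running (suc k) k<y with pos k<y
    ... | u , valk = trans (cong (next k) (running k (<⇒≤ k<y))) (next-running k valk)

    found : ∀ j → state (j + suc y) ≡ 2 + y
    found zero    = trans (cong (next y) (running y ≤-refl)) (next-running y root)
    found (suc j) = trans (cong (next (j + suc y)) (found j)) (next-found (j + suc y) y)

    search-complete : y < w → state w ≡ 2 + y
    search-complete y<w = subst (λ k → state k ≡ 2 + y) (m∸n+n≡m y<w) (found (w ∸ suc y))

bounded-prec : ∀ (f : Code n) g w k (xs : Vec ℕ n) →
  ⟦ bounded (precᶜ f g) ⟧ (input w (k ∷ xs)) ≡
  iter ⟦ bounded f ⟧ ⟦ bindₚ sndₚ (bounded g ∘ₚ stepArgs) ⟧ k (input w xs)
bounded-prec f g w k xs = trans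
  (cong ⟦ recₚ (bounded f) (bindₚ sndₚ (bounded g ∘ₚ stepArgs)) ⟧ (recArgs-eq w k (tuple xs)))
  (cong₂ (iter ⟦ bounded f ⟧ ⟦ bindₚ sndₚ (bounded g ∘ₚ stepArgs) ⟧) (fst-pair k _) (snd-pair k _))

Sound : Code n → Set
Sound e = ∀ w xs {y} → ⟦ bounded e ⟧ (input w xs) ≡ suc y → e [ xs ]⇓ y

mutual
  sound : (e : Code n) → Sound e
  sound zeroᶜ w [] refl = zero⇓
  sound sucᶜ w (x ∷ []) refl =
    retarget (sym (cong suc (trans (cong fst (snd-pair w _)) (fst-pair x _)))) suc⇓
  sound (projᶜ i) w xs refl =
    retarget (sym (trans (cong ⟦ nthₚ i ⟧ (snd-pair w _)) (nth-eq i xs))) proj⇓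
  sound (compᶜ f gs) w xs eq with bind-inv (boundeds gs) (bounded f ∘ₚ compArgs) (input w xs) eq
  ... | ys , eqs , eqf with sounds gs w xs eqs
  ...   | vs , refl , ds = comp⇓ ds
    (sound f w vs (trans (sym (cong ⟦ bounded f ⟧ (compArgs-eq (tuple vs) w (tuple xs)))) eqf))
  sound (precᶜ f g) w (k ∷ xs) eq =
    sound-rec f g w k xs (trans (sym (bounded-prec f g w k xs)) eq)
  sound (minᶜ f) w xs eq with search-sound (trans (sym bounded-min) eq)
    where open Search (bounded f) w xs
  ... | pos , root = min⇓ (λ {z} z<y → proj₁ (pos z<y) , sound f w (z ∷ xs) (proj₂ (pos z<y)))
                          (sound f w _ root)

  sound-rec : (f : Code n) (g : Code (2 + n)) → ∀ w k xs {y} →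
    iter ⟦ bounded f ⟧ ⟦ bindₚ sndₚ (bounded g ∘ₚ stepArgs) ⟧ k (input w xs) ≡ suc y →
    precᶜ f g [ k ∷ xs ]⇓ y
  sound-rec f g w zero xs eq = prec0⇓ (sound f w xs eq)
  sound-rec f g w (suc k) xs eq with bind-inv sndₚ (bounded g ∘ₚ stepArgs) _ eq
  ... | r , eqr , eqg = precs⇓ (sound-rec f g w k xs (trans (sym (snd-pair _ _)) eqr))
    (sound g w (k ∷ r ∷ xs)
      (trans (sym (cong ⟦ bounded g ⟧ (stepArgs-eq r k w (tuple xs) _))) eqg))

  sounds : ∀ {m} (gs : Vec (Code n) m) → ∀ w xs {ys} → ⟦ boundeds gs ⟧ (input w xs) ≡ suc ys →
           Σ[ vs ∈ Vec ℕ m ] tuple vs ≡ ys × Pointwise (λ g y → g [ xs ]⇓ y) gs vs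
  sounds [] w xs refl = [] , refl , []
  sounds (g ∷ gs) w xs eq with bind-inv (bounded g) (bindₚ (boundeds gs ∘ₚ sndₚ) consₚ) _ eq
  ... | y , eqg , eq′ with bind-inv (boundeds gs ∘ₚ sndₚ) consₚ (pair y (input w xs)) eq′
  ...   | ys , eqgs , eqc
    with sounds gs w xs (trans (sym (cong ⟦ boundeds gs ⟧ (snd-pair y _))) eqgs)
  ...     | vs , refl , ds = y ∷ vs ,
    suc-injective (trans (sym (cons-eq _ y _)) eqc) , sound g w xs eqg ∷ ds

Eventually : (ℕ → Set) → Set
Eventually P = ∃[ N ] ∀ m → N ≤ m → P m

both : ∀ {P Q R : ℕ → Set} → (∀ {m} → P m → Q m → R m) →
       Eventually P → Eventually Q → Eventually R
both f (M , p) (N , q) = M ⊔ N , λ m ≤m →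
  f (p m (≤-trans (m≤m⊔n M N) ≤m)) (q m (≤-trans (m≤n⊔m M N) ≤m))

mapᵉ : ∀ {P Q : ℕ → Set} → (∀ {m} → P m → Q m) → Eventually P → Eventually Q
mapᵉ f (M , p) = M , λ m ≤m → f (p m ≤m)

all-below : ∀ {P : ℕ → ℕ → Set} y → (∀ {i} → i < y → Eventually (P i)) →
            Eventually (λ m → ∀ {i} → i < y → P i m)
all-below zero    _ = 0 , λ _ _ ()
all-below {P} (suc y) p = both extend (p ≤-refl) (all-below y (λ i<y → p (m<n⇒m<1+n i<y)))
  where
  extend : ∀ {m} → P y m → (∀ {i} → i < y → P i m) → ∀ {i} → i < suc y → P i m
  extend py ps i<1+y with m≤n⇒m<n∨m≡n (s≤s⁻¹ i<1+y)
  ... | inj₁ i<y  = ps i<y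
  ... | inj₂ refl = py

mutual
  -- The bounds demanded by the subderivations combine by maximum because each of them works for all
  -- larger `w` too. A search with root `y` demands finitely many: one for each value up to `y`, and
  -- `y < w` itself.
  complete : ∀ {e : Code n} {xs y} → e [ xs ]⇓ y →
             Eventually (λ w → ⟦ bounded e ⟧ (input w xs) ≡ suc y)
  complete zero⇓ = 0 , λ _ _ → refl
  complete (suc⇓ {x}) = 0 , λ w _ → cong (2 +_) (trans (cong fst (snd-pair w _)) (fst-pair x _))
  complete (proj⇓ {xs = xs} {i}) = 0 , λ w _ →
    cong suc (trans (cong ⟦ nthₚ i ⟧ (snd-pair w _)) (nth-eq i xs))
  complete (comp⇓ {xs = xs} {ys = ys} {f = f} {gs} ds d) = both
    (λ {w} eqs eqf → trans (bind-suc (boundeds gs) (bounded f ∘ₚ compArgs) _ eqs)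
      (trans (cong ⟦ bounded f ⟧ (compArgs-eq (tuple ys) w (tuple xs))) eqf))
    (completes ds) (complete d)
  complete (prec0⇓ {xs = xs} {f = f} {g} d) =
    mapᵉ (λ {w} eq → trans (bounded-prec f g w 0 xs) eq) (complete d)
  complete (precs⇓ {xs = xs} {k} {y} {f = f} {g} d d′) = both
    (λ {w} eq eq′ → trans (bounded-prec f g w (suc k) xs)
      (trans (bind-suc sndₚ (bounded g ∘ₚ stepArgs) _
               (trans (snd-pair _ _) (trans (sym (bounded-prec f g w k xs)) eq)))
        (trans (cong ⟦ bounded g ⟧ (stepArgs-eq y k w (tuple xs) _)) eq′)))
    (complete d) (complete d′)
  complete (min⇓ {xs = xs} {y} {f} ds d) = both {P = y <_}
    (λ {w} → finish w) (suc y , λ _ p → p)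
    (both _,_ (all-below y (λ i<y → mapᵉ (_ ,_) (complete (proj₂ (ds i<y))))) (complete d))
    where
    finish : ∀ w → y < w →
             (∀ {i} → i < y → ∃[ u ] ⟦ bounded f ⟧ (input w (i ∷ xs)) ≡ 2 + u)
               × ⟦ bounded f ⟧ (input w (y ∷ xs)) ≡ 1 →
             ⟦ bounded (minᶜ f) ⟧ (input w xs) ≡ suc y
    finish w y<w (pos , root) = trans bounded-min (cong pred
      (Root.search-complete pos root y<w))
      where open Search (bounded f) w xs

  completes : ∀ {m} {gs : Vec (Code n) m} {xs ys} → Pointwise (λ g y → g [ xs ]⇓ y) gs ys →
              Eventually (λ w → ⟦ boundeds gs ⟧ (input w xs) ≡ suc (tuple ys))
  completes [] = 0 , λ _ _ → refl
  completes {gs = g ∷ gs} {ys = y ∷ ys} (d ∷ ds) = both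
    (λ eq eqs → trans (bind-suc (bounded g) (bindₚ (boundeds gs ∘ₚ sndₚ) consₚ) _ eq)
      (trans (bind-suc (boundeds gs ∘ₚ sndₚ) consₚ _
               (trans (cong ⟦ boundeds gs ⟧ (snd-pair y _)) eqs))
        (cons-eq _ y _)))
    (complete d) (completes ds)

-- Uniform enumeration of the c.e. sets

isPos : ℕ → Bool
isPos zero    = false
isPos (suc _) = true

-- The number `u` codes a search bound `fst u` together with a number of machine steps `snd u`, so
-- that `hits` has a single variable to search.
accept : ℕ → ℕ → ℕ → ℕ
accept u a y = output (run (snd u) (initial a (pair (fst u) (pair y 0))))

hits : ℕ → ℕ → ℕ → ℕ
hits zero    a y = 0
hits (suc s) a y = ifz (accept s a y) (hits s a y) 1

W : ℕ → ℕ → ωSet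
W a s y = isPos (hits s a y)

hitsᶜ : Computable f → Computable g → Computable h →
        Computable (λ v → hits (f v) (g v) (h v))
hitsᶜ = lift₃ hits (recᶜ _ (litᶜ 0)
  (ifzᶜ (ifzᶜ (fstᶜ final) (sndᶜ final) (litᶜ 0)) v₁ (litᶜ 1))
  (λ _ → refl) (λ _ _ → refl))
  where
  final : Computable {4} _
  final = runᶜ (sndᶜ v₀) (pairᶜ (pairᶜ v₂ (litᶜ 0)) (pairᶜ (fstᶜ v₀) (pairᶜ v₃ (litᶜ 0))))

ifz-true : ∀ c b → isPos (ifz c b 1) ≡ true → isPos c ≡ true ⊎ isPos b ≡ true
ifz-true zero    b p = inj₂ p
ifz-true (suc _) b _ = inj₁ refl

ifz-true₁ : ∀ c b → isPos c ≡ true → isPos (ifz c b 1) ≡ true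
ifz-true₁ (suc _) b _ = refl

ifz-true₂ : ∀ c b → isPos b ≡ true → isPos (ifz c b 1) ≡ true
ifz-true₂ zero    b p = p
ifz-true₂ (suc _) b _ = refl

pos⁻ : ∀ {x} → isPos x ≡ true → ∃[ y ] x ≡ suc y
pos⁻ {suc y} _ = y , refl

W-step : ∀ a s y → W a s y ≡ true → W a (suc s) y ≡ true
W-step a s y = ifz-true₂ (accept s a y) _

W-sound : ∀ (e : Code 1) s y → W (# bounded e) s y ≡ true → ∃[ z ] e [ y ∷ [] ]⇓ z
W-sound e (suc s) y p with ifz-true (accept s (# bounded e) y) _ p
... | inj₂ q = W-sound e s y q
... | inj₁ q with pos⁻ q
...   | z , eq = z , sound e (fst s) (y ∷ []) (output-sound (bounded e) _ (snd s) eq)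

W-complete : ∀ (e : Code 1) y → ∃[ z ] e [ y ∷ [] ]⇓ z → ∃[ s ] W (# bounded e) s y ≡ true
W-complete e y (z , d) with complete d
... | w , eq with output-complete (bounded e) (input w (y ∷ []))
...   | c , eqc =
  suc (pair w c) , ifz-true₁ (accept (pair w c) (# bounded e) y) _ (cong isPos accepts)
  where
  accepts : accept (pair w c) (# bounded e) y ≡ suc z
  accepts rewrite fst-pair w c | snd-pair w c = trans eqc (eq w ≤-refl)

cnt : ωSet → ℕ → ℕ
cnt X zero    = 0
cnt X (suc m) = bit (X m) + cnt X m

bit-isPos : ∀ x → ifz x 0 1 ≡ bit (isPos x)
bit-isPos zero    = refl
bit-isPos (suc _) = refl

countᶜ : Computable f → Computable g → Computable h →
         Computable (λ v → cnt (W (f v) (g v)) (h v))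
countᶜ A S M = lift₃ (λ m a s → cnt (W a s) m) (recᶜ _ (litᶜ 0)
  (ifzᶜ (hitsᶜ v₃ v₂ v₀) (litᶜ 0) (litᶜ 1) +ᶜ v₁)
  (λ _ → refl)
  (λ i v → cong (_+ cnt (W (lookup v zero) (lookup v (suc zero))) i)
             (bit-isPos (hits (lookup v (suc zero)) (lookup v zero) i)))) M A S

-- The columns

third : ℕ → ℕ
third x = x / 3

split : ∀ x → x ≡ x % 3 + third x * 3
split x = m≡m%n+[m/n]*n x 3

-- The quotient of x by 3 is the least q with x < 3 (q + 1).
thirdᶜ : Computable f → Computable (λ v → third (f v))
thirdᶜ = lift₁ third (minimizeᶜ _ (sucᶜ′ v₁ ∸ᶜ sucᶜ′ v₀ *ᶜ litᶜ 3)
  (λ v → m≤n⇒m∸n≡0 (bound (lookup v zero)))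
  (λ v i< eq → <⇒≱ (least (lookup v zero) i<) (m∸n≡0⇒m≤n eq)))
  where
  bound : ∀ x → x < suc (third x) * 3
  bound x = ≤-trans (s≤s (≤-reflexive (split x))) (+-monoˡ-≤ (third x * 3) (m%n<n x 3))
  least : ∀ x {i} → i < third x → suc i * 3 < suc x
  least x i< = s≤s (≤-trans (*-monoˡ-≤ 3 i<)
    (≤-trans (m≤n+m _ (x % 3)) (≤-reflexive (sym (split x)))))

shift : ℕ → ℕ → ℕ
shift zero    x = x
shift (suc k) x = third (shift k x)

shiftᶜ : Computable f → Computable g → Computable (λ v → shift (f v) (g v))
shiftᶜ = lift₂ shift (recᶜ _ v₀ (thirdᶜ v₁) (λ _ → refl) (λ _ _ → refl))

shift-third : ∀ k x → shift (suc k) x ≡ shift k (third x)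
shift-third zero    x = refl
shift-third (suc k) x = cong third (shift-third k x)

-- isTwo x is 1 if x ≡ 2 modulo 3, and 0 otherwise.
isTwo : ℕ → ℕ
isTwo x = 1 ∸ (2 ∸ (x ∸ third x * 3))

-- lev x is the exponent of 3 in suc x; the first argument of levF bounds
-- the recursion.
levF : ℕ → ℕ → ℕ
levF zero    x = 0
levF (suc t) x = ifz (isTwo x) 0 (suc (levF t (third x)))

lev : ℕ → ℕ
lev x = levF x x

third-0 : ∀ y → third (y * 3) ≡ y
third-0 y = m*n/n≡m y 3

third-1 : ∀ y → third (1 + y * 3) ≡ y
third-1 y = trans (+-distrib-/-∣ʳ 1 {d = 3} (divides y refl)) (m*n/n≡m y 3)

third-2 : ∀ y → third (2 + y * 3) ≡ y
third-2 y = trans (+-distrib-/-∣ʳ 2 {d = 3} (divides y refl)) (m*n/n≡m y 3)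

isTwo-third : ∀ x → isTwo x ≢ 0 → third x < x
isTwo-third zero    p = ⊥-elim (p refl)
isTwo-third (suc x) p = m/n<m (suc x) 3 (s≤s (s≤s z≤n))

-- The recursion of `levF` changes its parameter `x`, which `recᶜ` does not allow. With `levF-least`
-- this describes `lev x` as the result of a search, and in that form it is shown computable.
levF-root : ∀ t x → x ≤ t → isTwo (shift (levF t x) x) ≡ 0
levF-root zero    .0 z≤n = refl
levF-root (suc t) x  x≤t with isTwo x in eq
... | zero  = eq
... | suc _ = trans (cong isTwo (shift-third (levF t (third x)) x))
  (levF-root t (third x) (s≤s⁻¹ (≤-trans (isTwo-third x (λ e → 0≢1+n (trans (sym e) eq))) x≤t)))

levF-least : ∀ t x {i} → i < levF t x → isTwo (shift i x) ≢ 0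
levF-least (suc t) x {i} i< with isTwo x in eq
levF-least (suc t) x {zero}  i< | suc _ = λ e → 0≢1+n (trans (sym e) eq)
levF-least (suc t) x {suc i} i< | suc _ = λ e →
  levF-least t (third x) (s≤s⁻¹ i<) (trans (cong isTwo (sym (shift-third i x))) e)

levF-stable : ∀ t t′ x → x ≤ t → x ≤ t′ → levF t x ≡ levF t′ x
levF-stable zero    zero     x  _ _ = refl
levF-stable zero    (suc t′) .0 z≤n _ = refl
levF-stable (suc t) zero     .0 _ z≤n = refl
levF-stable (suc t) (suc t′) x  p q with isTwo x in eq
... | zero  = refl
... | suc _ = cong suc (levF-stable t t′ (third x) (s≤s⁻¹ (≤-trans x↓ p)) (s≤s⁻¹ (≤-trans x↓ q)))
  where
  x↓ : third x < x
  x↓ = isTwo-third x (λ e → 0≢1+n (trans (sym e) eq))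

levᶜ : Computable f → Computable (λ v → lev (f v))
levᶜ = lift₁ lev (minimizeᶜ _
  (litᶜ 1 ∸ᶜ (litᶜ 2 ∸ᶜ (shiftᶜ v₀ v₁ ∸ᶜ thirdᶜ (shiftᶜ v₀ v₁) *ᶜ litᶜ 3)))
  (λ v → levF-root (lookup v zero) (lookup v zero) ≤-refl)
  (λ v → levF-least (lookup v zero) (lookup v zero)))

-- The residues 0 and 1 modulo 3 make up column 0, and on residue 2 the whole partition repeats
-- itself one level higher. This self-similarity drives the induction for the density bounds.
lev-0 : ∀ y → lev (y * 3) ≡ 0
lev-0 zero    = refl
lev-0 (suc y) rewrite third-0 (suc y) | n∸n≡0 (y * 3) = refl

lev-1 : ∀ y → lev (1 + y * 3) ≡ 0
lev-1 y rewrite third-1 y | m+n∸n≡m 1 (y * 3) = refl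

lev-2 : ∀ y → lev (2 + y * 3) ≡ suc (lev y)
lev-2 y rewrite third-2 y | m+n∸n≡m 2 (y * 3) =
  cong suc (levF-stable _ _ y (m≤n⇒m≤1+n (m≤m*n y 3)) ≤-refl)

-- Blocks, tests and the approximation

-- blk n = pair e M says that column n lies in the block [M, M + 3^M), which is
-- reserved for requirement e.
blk : ℕ → ℕ
blk zero    = pair 0 0
blk (suc n) = ifz (snd (blk n) + 3 ^ snd (blk n) ∸ suc n)
                  (pair (suc (fst (blk n))) (suc n))
                  (blk n)

blkᶜ : Computable f → Computable (λ v → blk (f v))
blkᶜ = lift₁ blk (recᶜ _ (pairᶜ (litᶜ 0) (litᶜ 0))
  (ifzᶜ (sndᶜ v₁ +ᶜ litᶜ 3 ^ᶜ sndᶜ v₁ ∸ᶜ sucᶜ′ v₀) (pairᶜ (sucᶜ′ (fstᶜ v₁)) (sucᶜ′ v₀)) v₁)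
  (λ _ → refl) (λ _ _ → refl))

blk-next : ∀ M e j → blk (j + M) ≡ pair e M → suc j < 3 ^ M → blk (suc j + M) ≡ pair e M
blk-next M e j eq j< rewrite eq | snd-pair e M with M + 3 ^ M ∸ suc (j + M) in eqd
... | suc _ = refl
... | zero  = ⊥-elim (<⇒≱ j< (+-cancelʳ-≤ M _ _
  (≤-trans (≤-reflexive (+-comm _ M)) (m∸n≡0⇒m≤n eqd))))

blk-block : ∀ M e → blk M ≡ pair e M → ∀ j → j < 3 ^ M → blk (j + M) ≡ pair e M
blk-block M e eq zero    _  = eq
blk-block M e eq (suc j) j< = blk-next M e j (blk-block M e eq j (<⇒≤ j<)) j<

blk-start : ∀ e → ∃[ M ] blk M ≡ pair e M
blk-start zero = 0 , refl
blk-start (suc e) with blk-start e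
... | M , eq with 3 ^ M in eqp
...   | zero  = ⊥-elim (<⇒≢ (>-nonZero⁻¹ (3 ^ M) {{m^n≢0 3 M}}) (sym eqp))
...   | suc k = suc (k + M) , start-next
  where
  start-next : blk (suc (k + M)) ≡ pair (suc e) (suc (k + M))
  start-next rewrite blk-block M e eq k (≤-reflexive (sym eqp)) | snd-pair e M | eqp
    | fst-pair e M | +-suc M k | +-comm M k | n∸n≡0 (k + M) = refl

-- A requirement is a pair of a kind and an index. On column n = M + j of the block at M,
-- `target n / scale n` is (2 j 3^j + 1) / (2 · 3^n), that is j/3^M + 1/(2 · 3^n) over one
-- denominator.
kind prog offset scale target : ℕ → ℕ
kind n   = fst (fst (blk n))
prog n   = snd (fst (blk n))
offset n = n ∸ snd (blk n)
scale n  = 2 * 3 ^ n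
target n = suc (2 * (offset n * 3 ^ offset n))

-- The test of column n compares the density below m of a set A with the
-- threshold target n / scale n: it asks for a smaller density if kind n = 0,
-- when program prog n enumerates ∁ A, and for a larger one otherwise, when
-- prog n enumerates A.  The first inequality is stated without subtraction.
test : ℕ → ℕ → ℕ → ℕ
test n m s = ifz (kind n)
  (scale n * cnt (W (prog n) s) m + target n * m ∸ scale n * m)
  (scale n * cnt (W (prog n) s) m ∸ target n * m)

testᶜ : Computable f → Computable g → Computable h →
        Computable (λ v → test (f v) (g v) (h v))
testᶜ = lift₃ test (ifzᶜ (fstᶜ (fstᶜ (blkᶜ v₀)))
  (sc *ᶜ c +ᶜ ta *ᶜ v₁ ∸ᶜ sc *ᶜ v₁)
  (sc *ᶜ c ∸ᶜ ta *ᶜ v₁))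
  where
  off : Computable {3} (λ v → offset (lookup v zero))
  off = v₀ ∸ᶜ sndᶜ (blkᶜ v₀)
  sc : Computable {3} (λ v → scale (lookup v zero))
  sc = litᶜ 2 *ᶜ litᶜ 3 ^ᶜ v₀
  ta : Computable {3} (λ v → target (lookup v zero))
  ta = sucᶜ′ (litᶜ 2 *ᶜ (off *ᶜ litᶜ 3 ^ᶜ off))
  c : Computable {3} (λ v →
        cnt (W (prog (lookup v zero)) (lookup v (suc (suc zero)))) (lookup v (suc zero)))
  c = countᶜ (sndᶜ (fstᶜ (blkᶜ v₀))) v₂ v₁

fired : ℕ → ℕ → ℕ → ℕ → ℕ
fired zero    n x s = 0
fired (suc k) n x s = ifz (ifz (k ∸ x) 0 (test n k s)) (fired k n x s) 1

firedᶜ : Computable f → Computable g → Computable h → Computable k →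
         Computable (λ v → fired (f v) (g v) (h v) (k v))
firedᶜ = lift₄ fired (recᶜ _ (litᶜ 0)
  (ifzᶜ (ifzᶜ (v₀ ∸ᶜ v₃) (litᶜ 0) (testᶜ v₂ v₀ v₄)) v₁ (litᶜ 1))
  (λ _ → refl) (λ _ _ → refl))

-- Stage 0 must be 0. On a column of nonzero kind the value then becomes 1 at stage 1 and can fall
-- back to 0 once, when the test fires; on the other columns it can only rise once.
approx : ℕ → ℕ → ℕ
approx zero    x = 0
approx (suc s) x = ifz (kind (lev x)) (fired s (lev x) x s) (1 ∸ fired s (lev x) x s)

approxᶜ : Computable f → Computable g → Computable (λ v → approx (f v) (g v))
approxᶜ = lift₂ approx (recᶜ _ (litᶜ 0)
  (ifzᶜ (fstᶜ (fstᶜ (blkᶜ (levᶜ v₂)))) F (litᶜ 1 ∸ᶜ F))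
  (λ _ → refl) (λ _ _ → refl))
  where
  F : Computable {3} _
  F = firedᶜ v₀ (levᶜ v₂) v₂ v₀

guess : ℕ → ℕ → Bool
guess x s = isPos (approx s x)

guess-computable : Computable₂ guess
guess-computable = Computable.code c , λ x s → Computable.eval c (x ∷ s ∷ [])
  where
  c′ : Computable {2} (λ v → ifz (approx (lookup v (suc zero)) (lookup v zero)) 0 1)
  c′ = ifzᶜ (approxᶜ v₁ v₀) (litᶜ 0) (litᶜ 1)
  c : Computable {2} (λ v → bit (guess (lookup v zero) (lookup v (suc zero))))
  c = computable (Computable.code c′)
    (λ v → retarget (bit-isPos (approx (lookup v (suc zero)) (lookup v zero)))
                    (Computable.eval c′ v))

-- Counting a set that settles on every column

-- digits L z / 3^L is the density contributed by the columns below L if z is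
-- the sequence of their eventual values: column n has density 2 / 3^(n+1).
digits : ℕ → (ℕ → ℕ) → ℕ
digits zero    z = 0
digits (suc L) z = 2 * (3 ^ L * z 0) + digits L (z ∘ suc)

-- The definition splits off the first column, as the self-similarity requires; the diagonal
-- argument adds columns at the end instead.
digits-suc : ∀ L z → digits (suc L) z ≡ 3 * digits L z + 2 * z L
digits-suc zero    z = solve-base (z 0)
  where
  solve-base : ∀ x → 2 * (1 * x) + 0 ≡ 3 * 0 + 2 * x
  solve-base = solve-∀
digits-suc (suc L) z rewrite digits-suc L (z ∘ suc) =
  solve-step (3 ^ L) (z 0) (digits L (z ∘ suc)) (z (suc L))
  where
  solve-step : ∀ X x d y → 2 * (3 * X * x) + (3 * d + 2 * y) ≡ 3 * (2 * (X * x) + d) + 2 * y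
  solve-step = solve-∀

bit≤1 : ∀ b → bit b ≤ 1
bit≤1 false = z≤n
bit≤1 true  = ≤-refl

cnt-+≤ : ∀ X r m → cnt X (r + m) ≤ r + cnt X m
cnt-+≤ X zero    m = ≤-refl
cnt-+≤ X (suc r) m = +-mono-≤ (bit≤1 (X (r + m))) (cnt-+≤ X r m)

cnt-≤+ : ∀ X r m → cnt X m ≤ cnt X (r + m)
cnt-≤+ X zero    m = ≤-refl
cnt-≤+ X (suc r) m = ≤-trans (cnt-≤+ X r m) (m≤n+m _ (bit (X (r + m))))

cnt≤ : ∀ X m → cnt X m ≤ m
cnt≤ X zero    = z≤n
cnt≤ X (suc m) = +-mono-≤ (bit≤1 (X m)) (cnt≤ X m)

bounded-below : ∀ (u : ℕ → ℕ) N → ∃[ B ] ∀ q → q ≤ N → u q ≤ B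
bounded-below u zero = u 0 , λ { .0 z≤n → ≤-refl }
bounded-below u (suc N) with bounded-below u N
... | B , b = u (suc N) + B , bound
  where
  bound : ∀ q → q ≤ suc N → u q ≤ u (suc N) + B
  bound q q≤ with m≤n⇒m<n∨m≡n q≤
  ... | inj₁ q<   = ≤-trans (b q (s≤s⁻¹ q<)) (m≤n+m B _)
  ... | inj₂ refl = m≤m+n _ B

-- The hypothesis compares increments, crosswise to avoid subtraction: from `N` on, `u` grows no
-- faster than `v`, and `B` covers the values of `u` up to `N`.
eventual-growth : ∀ (u v : ℕ → ℕ) →
  Eventually (λ q → u (suc q) + v q ≤ v (suc q) + u q) → ∃[ B ] ∀ q → u q ≤ v q + B
eventual-growth u v (N , grow) with bounded-below u N
... | B , b = B , bound
  where
  later : ∀ j → u (j + N) ≤ v (j + N) + B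
  later zero    = ≤-trans (b N ≤-refl) (m≤n+m B (v N))
  later (suc j) = +-cancelʳ-≤ (v (j + N)) _ _ (begin
    u (suc j + N) + v (j + N)       ≤⟨ grow (j + N) (m≤n+m N j) ⟩
    v (suc j + N) + u (j + N)       ≤⟨ +-monoʳ-≤ (v (suc j + N)) (later j) ⟩
    v (suc j + N) + (v (j + N) + B) ≡⟨ rearrange (v (suc j + N)) (v (j + N)) B ⟩
    v (suc j + N) + B + v (j + N)   ∎)
    where
    open ≤-Reasoning
    rearrange : ∀ a b c → a + (b + c) ≡ a + c + b
    rearrange = solve-∀
  bound : ∀ q → u q ≤ v q + B
  bound q with ≤-total q N
  ... | inj₁ q≤N = ≤-trans (b q q≤N) (m≤n+m B (v q))
  ... | inj₂ N≤q = subst (λ q → u q ≤ v q + B) (m∸n+n≡m N≤q) (later (q ∸ N))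

Settles : ωSet → (ℕ → ℕ) → Set
Settles C z = ∀ n → Eventually (λ x → lev x ≡ n → bit (C x) ≡ z n)

-- The constant `B` absorbs the finite parts on which columns have not yet settled, so the bounds
-- hold for every `m` and pass through the induction on `L`.
Lower Upper : ωSet → ℕ → ℕ → Set
Lower C L p = ∃[ B ] ∀ m → p * m ≤ 3 ^ L * cnt C m + B
Upper C L p = ∃[ B ] ∀ m → 3 ^ L * cnt C m ≤ p * m + B

module Column (C : ωSet) (z : ℕ → ℕ) (settles : Settles C z) where

  C′ : ωSet
  C′ y = C (2 + y * 3)

  settles′ : Settles C′ (z ∘ suc)
  settles′ n = proj₁ (settles (suc n)) , λ y N≤y lev≡ →
    proj₂ (settles (suc n)) (2 + y * 3)
      (≤-trans N≤y (≤-trans (m≤m*n y 3) (m≤n+m _ 2)))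
      (trans (lev-2 y) (cong suc lev≡))

  -- From some point on, each triple 3q, 3q + 1, 3q + 2 contributes `z 0` twice, from column 0, and
  -- the bit of `C′` at q. Hence `flow q` is the count of `C` below 3q up to a constant.
  flow : ℕ → ℕ
  flow q = 2 * z 0 * q + cnt C′ q

  step-eq : Eventually (λ q → cnt C (suc q * 3) + flow q ≡ flow (suc q) + cnt C (q * 3))
  step-eq = proj₁ (settles 0) , λ q N≤q → eq q (≤-trans N≤q (m≤m*n q 3))
    where
    rearrange : ∀ x c d e q → c + (x + (x + e)) + (2 * x * q + d) ≡ 2 * x * (1 + q) + (c + d) + e
    rearrange = solve-∀
    eq : ∀ q → proj₁ (settles 0) ≤ q * 3 →
         cnt C (suc q * 3) + flow q ≡ flow (suc q) + cnt C (q * 3)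
    eq q N≤ rewrite proj₂ (settles 0) (1 + q * 3) (m≤n⇒m≤1+n N≤) (lev-1 q)
                  | proj₂ (settles 0) (q * 3) N≤ (lev-0 q) =
      rearrange (z 0) (bit (C′ q)) (cnt C′ q) (cnt C (q * 3)) q

  cnt≤flow : ∃[ B ] ∀ q → cnt C (q * 3) ≤ flow q + B
  cnt≤flow = eventual-growth (λ q → cnt C (q * 3)) flow (mapᵉ ≤-reflexive step-eq)

  flow≤cnt : ∃[ B ] ∀ q → flow q ≤ cnt C (q * 3) + B
  flow≤cnt = eventual-growth flow (λ q → cnt C (q * 3))
    (mapᵉ (λ {q} eq → ≤-reflexive (sym eq)) step-eq)

  upper : ∀ L p → Upper C′ L (suc p) → Upper C (suc L) (suc (2 * (3 ^ L * z 0) + p))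
  upper L p (B′ , b′) = 3 * X * (2 + B₁) + 3 * B′ , bound
    where
    X B₁ : ℕ
    X = 3 ^ L
    B₁ = proj₁ cnt≤flow
    expand : ∀ X x q c B → 3 * X * (2 + (2 * x * q + c + B)) ≡
                           3 * X * (2 * x * q) + 3 * X * (2 + B) + 3 * (X * c)
    expand = solve-∀
    collect : ∀ X x q p B D → 3 * X * (2 * x * q) + D + 3 * ((1 + p) * q + B)
                            ≡ (1 + (2 * (X * x) + p)) * (q * 3) + (D + 3 * B)
    collect = solve-∀
    bound : ∀ m → 3 * X * cnt C m ≤ suc (2 * (X * z 0) + p) * m + (3 * X * (2 + B₁) + 3 * B′)
    bound m = begin
      3 * X * cnt C m
        ≡⟨ cong (λ m → 3 * X * cnt C m) (split m) ⟩
      3 * X * cnt C (m % 3 + q * 3)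
        ≤⟨ *-monoʳ-≤ (3 * X) (≤-trans (cnt-+≤ C (m % 3) (q * 3))
             (+-mono-≤ (s≤s⁻¹ (m%n<n m 3)) (proj₂ cnt≤flow q))) ⟩
      3 * X * (2 + (2 * z 0 * q + cnt C′ q + B₁))
        ≡⟨ expand X (z 0) q (cnt C′ q) B₁ ⟩
      3 * X * (2 * z 0 * q) + 3 * X * (2 + B₁) + 3 * (X * cnt C′ q)
        ≤⟨ +-monoʳ-≤ (3 * X * (2 * z 0 * q) + 3 * X * (2 + B₁)) (*-monoʳ-≤ 3 (b′ q)) ⟩
      3 * X * (2 * z 0 * q) + 3 * X * (2 + B₁) + 3 * (suc p * q + B′)
        ≡⟨ collect X (z 0) q p B′ (3 * X * (2 + B₁)) ⟩
      suc (2 * (X * z 0) + p) * (q * 3) + (3 * X * (2 + B₁) + 3 * B′)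
        ≤⟨ +-monoˡ-≤ _ (*-monoʳ-≤ (suc (2 * (X * z 0) + p)) q*3≤m) ⟩
      suc (2 * (X * z 0) + p) * m + (3 * X * (2 + B₁) + 3 * B′) ∎
      where
      open ≤-Reasoning
      q : ℕ
      q = third m
      q*3≤m : q * 3 ≤ m
      q*3≤m = ≤-trans (m≤n+m (q * 3) (m % 3)) (≤-reflexive (sym (split m)))

  lower : ∀ L p → Lower C′ L p → Lower C (suc L) (2 * (3 ^ L * z 0) + p)
  lower L p (B′ , b′) = (2 * (X * z 0) + p) * 2 + 3 * B′ + 3 * X * B₂ , bound
    where
    X B₂ P : ℕ
    X = 3 ^ L
    B₂ = proj₁ flow≤cnt
    P = 2 * (X * z 0) + p
    expand : ∀ X x p q → (2 * (X * x) + p) * (2 + q * 3)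
                       ≡ (2 * (X * x) + p) * 2 + 3 * X * (2 * x * q) + 3 * (p * q)
    expand = solve-∀
    collect : ∀ X D x q c B → D + 3 * X * (2 * x * q) + 3 * (X * c + B) ≡
                              D + 3 * B + 3 * X * (2 * x * q + c)
    collect = solve-∀
    reorder : ∀ X D c B → D + 3 * X * (c + B) ≡ 3 * X * c + (D + 3 * X * B)
    reorder = solve-∀
    bound : ∀ m → P * m ≤ 3 * X * cnt C m + (P * 2 + 3 * B′ + 3 * X * B₂)
    bound m = begin
      P * m
        ≡⟨ cong (P *_) (split m) ⟩
      P * (m % 3 + q * 3)
        ≤⟨ *-monoʳ-≤ P (+-monoˡ-≤ (q * 3) (s≤s⁻¹ (m%n<n m 3))) ⟩
      P * (2 + q * 3)
        ≡⟨ expand X (z 0) p q ⟩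
      P * 2 + 3 * X * (2 * z 0 * q) + 3 * (p * q)
        ≤⟨ +-monoʳ-≤ (P * 2 + 3 * X * (2 * z 0 * q)) (*-monoʳ-≤ 3 (b′ q)) ⟩
      P * 2 + 3 * X * (2 * z 0 * q) + 3 * (X * cnt C′ q + B′)
        ≡⟨ collect X (P * 2) (z 0) q (cnt C′ q) B′ ⟩
      P * 2 + 3 * B′ + 3 * X * flow q
        ≤⟨ +-monoʳ-≤ (P * 2 + 3 * B′) (*-monoʳ-≤ (3 * X) (proj₂ flow≤cnt q)) ⟩
      P * 2 + 3 * B′ + 3 * X * (cnt C (q * 3) + B₂)
        ≤⟨ +-monoʳ-≤ (P * 2 + 3 * B′) (*-monoʳ-≤ (3 * X) (+-monoˡ-≤ B₂ cnt-q)) ⟩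
      P * 2 + 3 * B′ + 3 * X * (cnt C m + B₂)
        ≡⟨ reorder X (P * 2 + 3 * B′) (cnt C m) B₂ ⟩
      3 * X * cnt C m + (P * 2 + 3 * B′ + 3 * X * B₂) ∎
      where
      open ≤-Reasoning
      q : ℕ
      q = third m
      cnt-q : cnt C (q * 3) ≤ cnt C m
      cnt-q = ≤-trans (cnt-≤+ C (m % 3) (q * 3)) (≤-reflexive (cong (cnt C) (sym (split m))))

lower-bound : ∀ L C z → Settles C z → Lower C L (digits L z)
lower-bound zero    C z s = 0 , λ m → z≤n
lower-bound (suc L) C z s = lower L _ (lower-bound L C′ (z ∘ suc) settles′)
  where open Column C z s

-- The additional 1 in the numerator pays for all columns from `L` on, which have total density
-- 1/3^L and may be full.
upper-bound : ∀ L C z → Settles C z → Upper C L (suc (digits L z))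
upper-bound zero    C z s = 0 , λ m → begin
  1 * cnt C m ≡⟨ *-identityˡ (cnt C m) ⟩
  cnt C m     ≤⟨ cnt≤ C m ⟩
  m           ≡⟨ *-identityˡ m ⟨
  1 * m       ≤⟨ m≤m+n (1 * m) 0 ⟩
  1 * m + 0   ∎
  where open ≤-Reasoning
upper-bound (suc L) C z s = upper L _ (upper-bound L C′ (z ∘ suc) settles′)
  where open Column C z s

-- From counts to densities

-- a / m exceeds b / n by at most 1 / K.
Near : ℕ → ℕ → ℕ → ℕ → ℕ → Set
Near K a m b n = K * (a * n) ≤ K * (b * m) + m * n

k<3^k : ∀ k → k < 3 ^ k
k<3^k zero    = s≤s z≤n
k<3^k (suc k) = ≤-trans (s≤s (k<3^k k))
  (≤-trans (+-monoˡ-≤ (3 ^ k) (m^n>0 3 k))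
    (+-monoʳ-≤ (3 ^ k) (m≤m+n (3 ^ k) (3 ^ k + 0))))

-- Three errors of at most 1/X each add up: the distance of p/X and (p + 1)/X, and the constant `B`
-- once relative to `m` and once relative to `n`.
bounds⇒Near : ∀ K X p B {a m b n} .{{_ : NonZero X}} → 3 * K ≤ X → B ≤ m → B ≤ n →
              X * a ≤ suc p * m + B → p * n ≤ X * b + B → Near K a m b n
bounds⇒Near K X p B {a} {m} {b} {n} 3K≤X B≤m B≤n up lo = *-cancelˡ-≤ X (begin
  X * (K * (a * n))                               ≡⟨ e₁ K X a n ⟩
  K * (X * a * n)                                 ≤⟨ *-monoʳ-≤ K (*-monoˡ-≤ n up) ⟩
  K * ((suc p * m + B) * n)                       ≡⟨ cong (K *_) (e₂ p m n B) ⟩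
  K * (p * n * m + (m * n + B * n))               ≤⟨ *-monoʳ-≤ K (+-mono-≤ (*-monoˡ-≤ m lo)
                                                       (+-monoʳ-≤ (m * n) (*-monoˡ-≤ n B≤m))) ⟩
  K * ((X * b + B) * m + (m * n + m * n))         ≡⟨ e₃ K X b B m n ⟩
  X * (K * (b * m)) + K * (B * m + 2 * (m * n))   ≤⟨ +-monoʳ-≤ (X * (K * (b * m)))
                                                       (*-monoʳ-≤ K (+-monoˡ-≤ (2 * (m * n))
                                                         (*-monoˡ-≤ m B≤n))) ⟩
  X * (K * (b * m)) + K * (n * m + 2 * (m * n))   ≡⟨ cong (X * (K * (b * m)) +_) (e₄ K m n) ⟩
  X * (K * (b * m)) + 3 * K * (m * n)             ≤⟨ +-monoʳ-≤ (X * (K * (b * m)))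
                                                       (*-monoˡ-≤ (m * n) 3K≤X) ⟩
  X * (K * (b * m)) + X * (m * n)                 ≡⟨ *-distribˡ-+ X (K * (b * m)) (m * n) ⟨
  X * (K * (b * m) + m * n)                       ∎)
  where
  open ≤-Reasoning
  e₁ : ∀ K X a n → X * (K * (a * n)) ≡ K * (X * a * n)
  e₁ = solve-∀
  e₂ : ∀ p m n B → ((1 + p) * m + B) * n ≡ p * n * m + (m * n + B * n)
  e₂ = solve-∀
  e₃ : ∀ K X b B m n → K * ((X * b + B) * m + (m * n + m * n)) ≡
                       X * (K * (b * m)) + K * (B * m + 2 * (m * n))
  e₃ = solve-∀
  e₄ : ∀ K m n → K * (n * m + 2 * (m * n)) ≡ 3 * K * (m * n)
  e₄ = solve-∀

cauchy-cnt : ∀ C z → Settles C z → ∀ K →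
  ∃[ N ] ∀ m n → N ≤ m → N ≤ n → Near K (cnt C m) m (cnt C n) n
cauchy-cnt C z s K = B , λ m n B≤m B≤n →
  -- Level K + 1 suffices because K < 3^K. The larger error constant `B` also serves as the starting
  -- point.
  bounds⇒Near K (3 ^ suc K) (digits (suc K) z) B {cnt C m} {m} {cnt C n} {n}
    {{m^n≢0 3 (suc K)}} (*-monoʳ-≤ 3 (<⇒≤ (k<3^k K))) B≤m B≤n
    (≤-trans (proj₂ upper m) (+-monoʳ-≤ (suc (digits (suc K) z) * m) (m≤n⊔m _ _)))
    (≤-trans (proj₂ lower n) (+-monoʳ-≤ (3 ^ suc K * cnt C n) (m≤m⊔n _ _)))
  where
  lower : Lower C (suc K) (digits (suc K) z)
  lower = lower-bound (suc K) C z s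
  upper : Upper C (suc K) (suc (digits (suc K) z))
  upper = upper-bound (suc K) C z s
  B : ℕ
  B = proj₁ lower ⊔ proj₁ upper

opaque
  frac : ℕ → ℕ → ℚ
  frac a m = ⁺ a ℚ./ suc m

  toℚᵘ-frac : ∀ a m → toℚᵘ (frac a m) ℚᵘ.≃ mkℚᵘ (⁺ a) m
  toℚᵘ-frac a m = ℚ.toℚᵘ-fromℚᵘ (mkℚᵘ (⁺ a) m)

toℚᵘ-frac-+ : ∀ a m b n → toℚᵘ (frac a m ℚ.+ frac b n) ℚᵘ.≃ mkℚᵘ (⁺ a) m ℚᵘ.+ mkℚᵘ (⁺ b) n
toℚᵘ-frac-+ a m b n = ℚᵘ.≃-trans (ℚ.toℚᵘ-homo-+ (frac a m) (frac b n))
  (ℚᵘ.+-cong (toℚᵘ-frac a m) (toℚᵘ-frac b n))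

mkℚᵘ-+ : ∀ a m b n → mkℚᵘ (⁺ a) m ℚᵘ.+ mkℚᵘ (⁺ b) n ≡
         mkℚᵘ (⁺ (a * suc n + b * suc m)) (pred (suc m * suc n))
mkℚᵘ-+ a m b n = cong (λ i → mkℚᵘ i (pred (suc m * suc n))) (begin
  ⁺ a ℤ.* ⁺ suc n ℤ.+ ⁺ b ℤ.* ⁺ suc m ≡⟨ cong₂ ℤ._+_ (ℤ.pos-* a (suc n)) (ℤ.pos-* b (suc m)) ⟨
  ⁺ (a * suc n) ℤ.+ ⁺ (b * suc m)     ≡⟨ ℤ.pos-+ (a * suc n) (b * suc m) ⟨
  ⁺ (a * suc n + b * suc m)           ∎)
  where open ≡-Reasoning

mkℚᵘ-≤ : ∀ {a m b n} → a * suc n ≤ b * suc m → mkℚᵘ (⁺ a) m ℚᵘ.≤ mkℚᵘ (⁺ b) n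
mkℚᵘ-≤ {a} {m} {b} {n} p = ℚᵘ.*≤*
  (subst₂ ℤ._≤_ (ℤ.pos-* a (suc n)) (ℤ.pos-* b (suc m)) (+≤+ p))

mkℚᵘ-≤⁻¹ : ∀ {a m b n} → mkℚᵘ (⁺ a) m ℚᵘ.≤ mkℚᵘ (⁺ b) n → a * suc n ≤ b * suc m
mkℚᵘ-≤⁻¹ {a} {m} {b} {n} (ℚᵘ.*≤* p) = ℤ.drop‿+≤+
  (subst₂ ℤ._≤_ (sym (ℤ.pos-* a (suc n))) (sym (ℤ.pos-* b (suc m))) p)

near-l : ∀ k a n → suc k * (a * suc n) ≡ a * (suc n * suc k)
near-l = solve-∀

near-r : ∀ k m b n → suc k * (b * suc m) + suc m * suc n ≡ (b * suc k + 1 * suc n) * suc m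
near-r = solve-∀

Near⇒≤ : ∀ k a m b n → Near (suc k) a (suc m) b (suc n) →
         frac a m ℚ.≤ frac b n ℚ.+ frac 1 k
Near⇒≤ k a m b n p = ℚ.toℚᵘ-cancel-≤
  (ℚᵘ.≤-respˡ-≃ (ℚᵘ.≃-sym (toℚᵘ-frac a m)) (ℚᵘ.≤-respʳ-≃ (ℚᵘ.≃-sym (toℚᵘ-frac-+ b n 1 k))
    (subst (mkℚᵘ (⁺ a) m ℚᵘ.≤_) (sym (mkℚᵘ-+ b n 1 k))
      (mkℚᵘ-≤ (subst₂ _≤_ (near-l k a n) (near-r k m b n) p)))))

≤⇒Near : ∀ k a m b n → frac a m ℚ.≤ frac b n ℚ.+ frac 1 k →
         Near (suc k) a (suc m) b (suc n)
≤⇒Near k a m b n p = subst₂ _≤_ (sym (near-l k a n)) (sym (near-r k m b n))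
  (mkℚᵘ-≤⁻¹ (subst (mkℚᵘ (⁺ a) m ℚᵘ.≤_) (mkℚᵘ-+ b n 1 k)
    (ℚᵘ.≤-respˡ-≃ (toℚᵘ-frac a m) (ℚᵘ.≤-respʳ-≃ (toℚᵘ-frac-+ b n 1 k) (ℚ.toℚᵘ-mono-≤ p)))))

-- Since `frac 1 k` is 1/(k + 1), its half has denominator 2k + 2, the successor of `k + suc k`.
half+half : ∀ k → frac 1 (k + suc k) ℚ.+ frac 1 (k + suc k) ℚ.≤ frac 1 k
half+half k = ℚ.toℚᵘ-cancel-≤
  (ℚᵘ.≤-respˡ-≃ (ℚᵘ.≃-sym (toℚᵘ-frac-+ 1 half 1 half)) (ℚᵘ.≤-respʳ-≃ (ℚᵘ.≃-sym (toℚᵘ-frac 1 k))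
    (subst (ℚᵘ._≤ mkℚᵘ (⁺ 1) k) (sym (mkℚᵘ-+ 1 half 1 half)) (mkℚᵘ-≤ (≤-reflexive (eq k))))))
  where
  half : ℕ
  half = k + suc k
  eq : ∀ k → (1 * suc (k + suc k) + 1 * suc (k + suc k)) * suc k ≡
             1 * (suc (k + suc k) * suc (k + suc k))
  eq = solve-∀

0<frac : ∀ k → 0ℚ ℚ.< frac 1 k
0<frac k = ℚ.toℚᵘ-cancel-< (ℚᵘ.<-respʳ-≃ (ℚᵘ.≃-sym (toℚᵘ-frac 1 k)) (ℚᵘ.*<* (+<+ (s≤s z≤n))))

archimedean : ∀ ε → 0ℚ ℚ.< ε → ∃[ k ] frac 1 k ℚ.< ε
archimedean ε@(mkℚ (⁺ zero) d _) (ℚ.*<* (+<+ ()))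
-- Here ε = (n + 1)/(d + 1) is at least 1/(d + 1), hence greater than 1/(d + 2).
archimedean ε@(mkℚ ℤ.+[1+ n ] d _) _ = suc d , ℚ.toℚᵘ-cancel-<
  (ℚᵘ.<-respˡ-≃ (ℚᵘ.≃-sym (toℚᵘ-frac 1 (suc d))) (ℚᵘ.*<*
    (subst₂ ℤ._<_ (ℤ.pos-* 1 (suc d)) (ℤ.pos-* (suc n) (2 + d)) (+<+ (bound n d)))))
  where
  bound : ∀ n d → 1 * suc d < suc n * (2 + d)
  bound n d = ≤-trans (≤-reflexive (cong suc (*-identityˡ (suc d)))) (m≤m+n (2 + d) _)

minus-left : ∀ y z → (y ℚ.+ z) ℚ.- y ≡ z
minus-left y z = begin
  (y ℚ.+ z) ℚ.- y     ≡⟨ cong (ℚ._- y) (ℚ.+-comm y z) ⟩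
  (z ℚ.+ y) ℚ.- y     ≡⟨ ℚ.+-assoc z y (ℚ.- y) ⟩
  z ℚ.+ (y ℚ.- y)     ≡⟨ cong (z ℚ.+_) (ℚ.+-inverseʳ y) ⟩
  z ℚ.+ 0ℚ            ≡⟨ ℚ.+-identityʳ z ⟩
  z                   ∎
  where open ≡-Reasoning

plus-minus : ∀ x y → y ℚ.+ (x ℚ.- y) ≡ x
plus-minus x y = begin
  y ℚ.+ (x ℚ.- y)     ≡⟨ ℚ.+-assoc y x (ℚ.- y) ⟨
  (y ℚ.+ x) ℚ.- y     ≡⟨ minus-left y x ⟩
  x                   ∎
  where open ≡-Reasoning

neg-minus : ∀ x y → ℚ.- (x ℚ.- y) ≡ y ℚ.- x
neg-minus x y = begin
  ℚ.- (x ℚ.- y)         ≡⟨ ℚ.neg-distrib-+ x (ℚ.- y) ⟩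
  ℚ.- x ℚ.+ ℚ.- ℚ.- y   ≡⟨ cong (ℚ.- x ℚ.+_) (⁻¹-involutive y) ⟩
  ℚ.- x ℚ.+ y           ≡⟨ ℚ.+-comm (ℚ.- x) y ⟩
  y ℚ.- x               ∎
  where
  open ≡-Reasoning
  open import Algebra.Properties.Group ℚ.+-0-group using (⁻¹-involutive)

≤⇒∣-∣≤ : ∀ x y {z} → x ℚ.≤ y ℚ.+ z → y ℚ.≤ x ℚ.+ z → ℚ.∣ x ℚ.- y ∣ ℚ.≤ z
≤⇒∣-∣≤ x y {z} p q with ℚ.∣p∣≡p∨∣p∣≡-p (x ℚ.- y)
... | inj₁ eq rewrite eq =
  subst (x ℚ.- y ℚ.≤_) (minus-left y z) (ℚ.+-monoˡ-≤ (ℚ.- y) p)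
... | inj₂ eq rewrite eq | neg-minus x y =
  subst (y ℚ.- x ℚ.≤_) (minus-left x z) (ℚ.+-monoˡ-≤ (ℚ.- x) q)

p≤∣p∣ : ∀ p → p ℚ.≤ ℚ.∣ p ∣
p≤∣p∣ p with ℚ.≤-total p 0ℚ
... | inj₁ p≤0 = ℚ.≤-trans p≤0 (ℚ.0≤∣p∣ p)
... | inj₂ 0≤p = ℚ.≤-reflexive (sym (ℚ.0≤p⇒∣p∣≡p 0≤p))

∣-∣≤⇒≤ : ∀ x y {z} → ℚ.∣ x ℚ.- y ∣ ℚ.≤ z → x ℚ.≤ y ℚ.+ z
∣-∣≤⇒≤ x y p = subst (ℚ._≤ y ℚ.+ _) (plus-minus x y)
  (ℚ.+-monoʳ-≤ y (ℚ.≤-trans (p≤∣p∣ (x ℚ.- y)) p))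

∣-∣-sym : ∀ x y → ℚ.∣ x ℚ.- y ∣ ≡ ℚ.∣ y ℚ.- x ∣
∣-∣-sym x y = trans (sym (ℚ.∣-p∣≡∣p∣ (x ℚ.- y))) (cong ℚ.∣_∣ (neg-minus x y))

length-filter-upTo : ∀ X m → length (filterᵇ X (upTo m)) ≡ cnt X m
length-filter-upTo X zero    = refl
length-filter-upTo X (suc m) = begin
  length (filterᵇ X (upTo (suc m)))
    ≡⟨ cong (λ xs → length (filterᵇ X xs)) (List.upTo-∷ʳ m) ⟨
  length (filterᵇ X (upTo m List.∷ʳ m))
    ≡⟨ filter-∷ʳ (upTo m) ⟩
  bit (X m) + length (filterᵇ X (upTo m))
    ≡⟨ cong (bit (X m) +_) (length-filter-upTo X m) ⟩
  bit (X m) + cnt X m ∎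
  where
  open ≡-Reasoning
  filter-∷ʳ : ∀ xs → length (filterᵇ X (xs List.∷ʳ m)) ≡ bit (X m) + length (filterᵇ X xs)
  filter-∷ʳ List.[] with X m
  ... | true  = refl
  ... | false = refl
  filter-∷ʳ (x List.∷ xs) with X x
  ... | true  = trans (cong suc (filter-∷ʳ xs)) (sym (+-suc (bit (X m)) _))
  ... | false = filter-∷ʳ xs

opaque
  unfolding frac

  ρ-cnt : ∀ X m → ρ X (suc m) ≡ frac (cnt X (suc m)) m
  ρ-cnt X m = cong (λ a → frac a m) (length-filter-upTo X (suc m))

cauchy-limit : ∀ (u : ℕ → ℚ) →
  (∀ k → ∃[ N ] ∀ m n → N ≤ m → N ≤ n → ℚ.∣ u m ℚ.- u n ∣ ℚ.≤ frac 1 k) →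
  Σ[ r ∈ ℝ ] ∀ ε → 0ℚ ℚ.< ε → Eventually (λ m → Within (u m) r ε)
cauchy-limit u close = r , converges
  where
  r : ℝ
  ℝ.seq r = u
  ℝ.cauchy r ε 0<ε with archimedean ε 0<ε
  ... | k , k<ε = proj₁ (close k) , λ m n N≤m N≤n →
    ℚ.≤-<-trans (proj₂ (close k) m n N≤m N≤n) k<ε

  converges : ∀ ε → 0ℚ ℚ.< ε → Eventually (λ m → Within (u m) r ε)
  converges ε 0<ε with archimedean ε 0<ε
  ... | k , k<ε = proj₁ (close k) , λ m N≤m →
    frac 1 k , k<ε , proj₁ (close k) , λ n N≤n → proj₂ (close k) m n N≤m N≤n

Near⇒∣-∣≤ : ∀ k a m b n → Near (suc k) a (suc m) b (suc n) → Near (suc k) b (suc n) a (suc m) →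
            ℚ.∣ frac a m ℚ.- frac b n ∣ ℚ.≤ frac 1 k
Near⇒∣-∣≤ k a m b n p q =
  ≤⇒∣-∣≤ (frac a m) (frac b n) (Near⇒≤ k a m b n p) (Near⇒≤ k b n a m q)

density : ∀ C → (∀ K → ∃[ N ] ∀ m n → N ≤ m → N ≤ n → Near K (cnt C m) m (cnt C n) n) →
          ∃[ r ] HasDensity C r
density C near = proj₁ lim , dens
  where
  freq : ℕ → ℚ
  freq m = frac (cnt C (suc m)) m

  lim : Σ[ r ∈ ℝ ] ∀ ε → 0ℚ ℚ.< ε → Eventually (λ m → Within (freq m) r ε)
  lim = cauchy-limit freq λ k → proj₁ (near (suc k)) , λ m n N≤m N≤n →
    Near⇒∣-∣≤ k (cnt C (suc m)) m (cnt C (suc n)) n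
      (proj₂ (near (suc k)) (suc m) (suc n) (m≤n⇒m≤1+n N≤m) (m≤n⇒m≤1+n N≤n))
      (proj₂ (near (suc k)) (suc n) (suc m) (m≤n⇒m≤1+n N≤n) (m≤n⇒m≤1+n N≤m))

  dens : HasDensity C (proj₁ lim)
  dens ε 0<ε = suc (proj₁ (proj₂ lim ε 0<ε)) , λ { (suc m) (s≤s N≤m) →
    subst (λ q → Within q (proj₁ lim) ε) (sym (ρ-cnt C m)) (proj₂ (proj₂ lim ε 0<ε) m N≤m) }

Within⇒≤ : ∀ x y r k → Within x r (frac 1 (k + suc k)) → Within y r (frac 1 (k + suc k)) →
           x ℚ.≤ y ℚ.+ frac 1 k
Within⇒≤ x y r k (δ , δ<½ , M , p) (δ′ , δ′<½ , M′ , p′) = begin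
  x                    ≤⟨ ∣-∣≤⇒≤ x s (ℚ.≤-trans (p (M ⊔ M′) (m≤m⊔n M M′)) (ℚ.<⇒≤ δ<½)) ⟩
  s ℚ.+ half           ≤⟨ ℚ.+-monoˡ-≤ half (∣-∣≤⇒≤ s y (subst (ℚ._≤ half) (∣-∣-sym y s)
                            (ℚ.≤-trans (p′ (M ⊔ M′) (m≤n⊔m M M′)) (ℚ.<⇒≤ δ′<½)))) ⟩
  y ℚ.+ half ℚ.+ half  ≡⟨ ℚ.+-assoc y half half ⟩
  y ℚ.+ (half ℚ.+ half) ≤⟨ ℚ.+-monoʳ-≤ y (half+half k) ⟩
  y ℚ.+ frac 1 k       ∎
  where
  open ℚ.≤-Reasoning
  s half : ℚ
  s = ℝ.seq r (M ⊔ M′)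
  half = frac 1 (k + suc k)

Near-cancel : ∀ k a b m → Near (suc k) a (suc m) b (suc m) → suc k * a ≤ suc k * b + suc m
Near-cancel k a b m p = *-cancelʳ-≤ (suc k * a) (suc k * b + suc m) (suc m)
  (subst₂ _≤_ (lhs k a m) (rhs k b m) p)
  where
  lhs : ∀ k a m → suc k * (a * suc m) ≡ suc k * a * suc m
  lhs = solve-∀
  rhs : ∀ k a m → suc k * (a * suc m) + suc m * suc m ≡ (suc k * a + suc m) * suc m
  rhs = solve-∀

-- Equality of densities in integers: eventually the frequencies differ by at most 1/K. The real `r`
-- enters the diagonal argument only through this.
densities-near : ∀ {A C r} → HasDensity A r → HasDensity C r → ∀ K →
                 Eventually (λ m → K * cnt A m ≤ K * cnt C m + m)
densities-near dA dC zero = 0 , λ _ _ → z≤n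
densities-near {A} {C} {r} dA dC (suc k) =
  suc (proj₁ (dA ε (0<frac _)) ⊔ proj₁ (dC ε (0<frac _))) , λ { (suc m) (s≤s N≤m) →
    Near-cancel k (cnt A (suc m)) (cnt C (suc m)) m
      (≤⇒Near k (cnt A (suc m)) m (cnt C (suc m)) m
        (subst₂ (λ x y → x ℚ.≤ y ℚ.+ frac 1 k) (ρ-cnt A m) (ρ-cnt C m)
          (Within⇒≤ (ρ A (suc m)) (ρ C (suc m)) r k
            (proj₂ (dA ε (0<frac _)) (suc m) (m≤n⇒m≤1+n (≤-trans (m≤m⊔n _ _) N≤m)))
            (proj₂ (dC ε (0<frac _)) (suc m) (m≤n⇒m≤1+n (≤-trans (m≤n⊔m _ _) N≤m)))))) }
  where
  ε : ℚ
  ε = frac 1 (k + suc k)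

-- Correctness of the tests

infix 4 _⊆_

_⊆_ : ωSet → ωSet → Set
X ⊆ Y = ∀ y → X y ≡ true → Y y ≡ true

bit-mono : ∀ {a b} → (a ≡ true → b ≡ true) → bit a ≤ bit b
bit-mono {false} _ = z≤n
bit-mono {true} {b} p rewrite p refl = ≤-refl

cnt-mono : ∀ {X Y} → X ⊆ Y → ∀ m → cnt X m ≤ cnt Y m
cnt-mono p zero    = z≤n
cnt-mono p (suc m) = +-mono-≤ (bit-mono (p m)) (cnt-mono p m)

cnt-∁ : ∀ X m → cnt X m + cnt (∁ X) m ≡ m
cnt-∁ X zero    = refl
cnt-∁ X (suc m) with X m
... | true  = cong suc (cnt-∁ X m)
... | false = trans (+-suc (cnt X m) (cnt (∁ X) m)) (cong suc (cnt-∁ X m))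

isPos-∸ : ∀ a b → isPos (a ∸ b) ≡ true → b < a
isPos-∸ (suc a) zero    _ = s≤s z≤n
isPos-∸ (suc a) (suc b) p = s≤s (isPos-∸ a b p)

∸-isPos : ∀ {a b} → b < a → isPos (a ∸ b) ≡ true
∸-isPos {suc a} {zero}  _ = refl
∸-isPos {suc a} {suc b} p = ∸-isPos (s≤s⁻¹ p)

isPos-mono : ∀ {a b} → a ≤ b → isPos a ≡ true → isPos b ≡ true
isPos-mono {suc a} {suc b} _ _ = refl

W-mono : ∀ a {s t} → s ≤ t → W a s ⊆ W a t
W-mono a {s} s≤t y p = subst (λ t → W a t y ≡ true) (m∸n+n≡m s≤t) (go (_ ∸ s))
  where
  go : ∀ j → W a (j + s) y ≡ true
  go zero    = p
  go (suc j) = W-step a (j + s) y (go j)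

ifz-mono : ∀ c {a a′ b b′} → a ≤ a′ → b ≤ b′ → ifz c a b ≤ ifz c a′ b′
ifz-mono zero    p q = p
ifz-mono (suc _) p q = q

test-mono : ∀ n m {s t} → s ≤ t → test n m s ≤ test n m t
test-mono n m {s} {t} s≤t = ifz-mono (kind n)
  (∸-monoˡ-≤ (scale n * m) (+-monoˡ-≤ (target n * m) scaled))
  (∸-monoˡ-≤ (target n * m) scaled)
  where
  scaled : scale n * cnt (W (prog n) s) m ≤ scale n * cnt (W (prog n) t) m
  scaled = *-monoʳ-≤ (scale n) (cnt-mono (W-mono (prog n) s≤t) m)

Enumerates : ℕ → ωSet → Set
Enumerates a X = (∀ s → W a s ⊆ X) × (∀ y → X y ≡ true → ∃[ s ] W a s y ≡ true)

CE-index : ∀ {X} → CE X → ∃[ a ] Enumerates a X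
CE-index {X} (e , spec) = # bounded e ,
  (λ s y p → Equivalence.from (spec y) (W-sound e s y p)) ,
  (λ y p → W-complete e y (Equivalence.to (spec y) p))

-- Only finitely many elements lie below `m`, so the maximum of their stages catches all of them.
stage-count : ∀ {a X} → Enumerates a X → ∀ m → ∃[ s ] cnt X m ≤ cnt (W a s) m
stage-count E zero = 0 , z≤n
stage-count {a} {X} E (suc m) with stage-count E m | X m in eq
... | s , p | false = s , ≤-trans p (m≤n+m _ (bit (W a s m)))
... | s , p | true with proj₂ E m eq
...   | t , q = s ⊔ t , +-mono-≤
  (bit-mono {true} (λ _ → W-mono a (m≤n⊔m s t) m q))
  (≤-trans p (cnt-mono (W-mono a (m≤m⊔n s t)) m))

Success : ℕ → ℕ → Set
Success n m = ∃[ s ] isPos (test n m s) ≡ true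

-- Few elements in `A` means many in `∁ A`, and the count of `∁ A` can be approximated from below;
-- `cnt-∁` turns one inequality into the other.
success⇔< : ∀ {n A} → kind n ≡ 0 → Enumerates (prog n) (∁ A) → ∀ m →
            Success n m ⇔ scale n * cnt A m < target n * m
success⇔< {n} {A} k0 E m = mk⇔ to from
  where
  S T : ℕ
  S = scale n
  T = target n
  total : S * m ≡ S * cnt A m + S * cnt (∁ A) m
  total = trans (cong (S *_) (sym (cnt-∁ A m))) (*-distribˡ-+ S (cnt A m) (cnt (∁ A) m))
  commute : S * cnt (∁ A) m + T * m ≡ T * m + S * cnt (∁ A) m
  commute = +-comm (S * cnt (∁ A) m) (T * m)
  to : Success n m → S * cnt A m < T * m
  to (s , p) rewrite k0 = +-cancelʳ-< (S * cnt (∁ A) m) _ _ (subst₂ _<_ total commute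
    (<-≤-trans (isPos-∸ _ (S * m) p)
      (+-monoˡ-≤ (T * m) (*-monoʳ-≤ S (cnt-mono (proj₁ E s) m)))))
  from : S * cnt A m < T * m → Success n m
  from p with stage-count E m
  ... | s , q rewrite k0 = s , ∸-isPos (<-≤-trans
    (subst₂ _<_ (sym total) (sym commute) (+-monoˡ-< (S * cnt (∁ A) m) p))
    (+-monoˡ-≤ (T * m) (*-monoʳ-≤ S q)))

success⇔> : ∀ {n A} → kind n ≡ 1 → Enumerates (prog n) A → ∀ m →
            Success n m ⇔ target n * m < scale n * cnt A m
success⇔> {n} {A} k1 E m = mk⇔ to from
  where
  to : Success n m → target n * m < scale n * cnt A m
  to (s , p) rewrite k1 = <-≤-trans (isPos-∸ _ (target n * m) p)
    (*-monoʳ-≤ (scale n) (cnt-mono (proj₁ E s) m))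
  from : target n * m < scale n * cnt A m → Success n m
  from p with stage-count E m
  ... | s , q rewrite k1 = s , ∸-isPos (<-≤-trans p (*-monoʳ-≤ (scale n) q))

Fires : ℕ → ℕ → Set
Fires n x = ∃[ m ] x < m × Success n m

fired-sound : ∀ k n x s → isPos (fired k n x s) ≡ true → Fires n x
fired-sound (suc k) n x s p with ifz-true (ifz (k ∸ x) 0 (test n k s)) _ p
... | inj₂ q = fired-sound k n x s q
... | inj₁ q with k ∸ x in eq
...   | suc _ = k , isPos-∸ k x (cong isPos eq) , s , q

fired-hit : ∀ n x s m → x < m → isPos (test n m s) ≡ true →
            isPos (ifz (m ∸ x) 0 (test n m s)) ≡ true
fired-hit n x s m x<m p with m ∸ x | ∸-isPos x<m
... | suc _ | _ = p

fired-complete : ∀ k n x s {m} → x < m → m < k → isPos (test n m s) ≡ true →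
                 isPos (fired k n x s) ≡ true
fired-complete (suc k) n x s {m} x<m m<k p with m≤n⇒m<n∨m≡n (s≤s⁻¹ m<k)
... | inj₁ m<k′ = ifz-true₂ (ifz (k ∸ x) 0 (test n k s)) _ (fired-complete k n x s x<m m<k′ p)
... | inj₂ refl = ifz-true₁ _ _ (fired-hit n x s m x<m p)

fired-mono : ∀ k n x s → isPos (fired k n x s) ≡ true →
             isPos (fired (suc k) n x (suc s)) ≡ true
fired-mono k n x s p with witness k p
  where
  witness : ∀ k → isPos (fired k n x s) ≡ true →
            ∃[ m ] x < m × m < k × isPos (test n m s) ≡ true
  witness (suc k) p with ifz-true (ifz (k ∸ x) 0 (test n k s)) _ p
  ... | inj₂ q = map₂ (map₂ (map₁ m<n⇒m<1+n)) (witness k q)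
  ... | inj₁ q with k ∸ x in eq
  ...   | suc _ = k , isPos-∸ k x (cong isPos eq) , ≤-refl , q
... | m , x<m , m<k , q = fired-complete (suc k) n x (suc s) x<m (m<n⇒m<1+n m<k)
  (isPos-mono (test-mono n m (n≤1+n s)) q)

flip : ℕ → Bool → Bool
flip zero    b = b
flip (suc _) b = not b

isPos-flip : ∀ k f → isPos (ifz k f (1 ∸ f)) ≡ flip k (isPos f)
isPos-flip zero    f       = refl
isPos-flip (suc _) zero    = refl
isPos-flip (suc _) (suc f) rewrite 0∸n≡0 f = refl

-- The diagonal argument

digits<3^ : ∀ L z → (∀ n → z n ≤ 1) → digits L z < 3 ^ L
digits<3^ zero    z z≤1 = s≤s z≤n
digits<3^ (suc L) z z≤1 = begin-strict
  2 * (3 ^ L * z 0) + digits L (z ∘ suc)  ≤⟨ +-monoˡ-≤ _ (*-monoʳ-≤ 2 (*-monoʳ-≤ (3 ^ L) (z≤1 0))) ⟩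
  2 * (3 ^ L * 1) + digits L (z ∘ suc)    ≡⟨ cong (λ x → 2 * x + digits L (z ∘ suc)) (*-identityʳ (3 ^ L)) ⟩
  2 * 3 ^ L + digits L (z ∘ suc)          <⟨ +-monoʳ-< (2 * 3 ^ L)
                                               (digits<3^ L (z ∘ suc) (z≤1 ∘ suc)) ⟩
  2 * 3 ^ L + 3 ^ L                       ≡⟨ +-comm (2 * 3 ^ L) (3 ^ L) ⟩
  3 ^ suc L                               ∎
  where open ≤-Reasoning

module Comparison {A C r} (dA : HasDensity A r) (dC : HasDensity C r) where

  private
    double : ∀ S c m → 2 * S * c + m + m ≡ 2 * (S * c + m)
    double = solve-∀
    dist : ∀ S c B → 2 * (S * c + B) ≡ 2 * S * c + 2 * B
    dist = solve-∀
    halve : ∀ S a T b → 2 * S * a < 2 * T * b → S * a < T * b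
    halve S a T b p = *-cancelˡ-< 2 (S * a) (T * b)
      (subst₂ _<_ (*-assoc 2 S a) (*-assoc 2 T b) p)

  -- The hypothesis leaves a margin of 1/S above the threshold T/S. Half of it covers the difference
  -- between the frequencies of `A` and `C`, the other half outweighs `B` as soon as m > 2B.
  above : ∀ S T → (∃[ B ] ∀ m → T * m + m ≤ S * cnt C m + B) →
          Eventually (λ m → T * m < S * cnt A m)
  above S T (B , b) = both {P = 2 * B <_} go (suc (2 * B) , λ _ p → p)
    (densities-near {C} {A} {r} dC dA (2 * S))
    where
    open ≤-Reasoning
    go : ∀ {m} → 2 * B < m → 2 * S * cnt C m ≤ 2 * S * cnt A m + m → T * m < S * cnt A m
    go {m} B<m near = halve T m S (cnt A m) (+-cancelʳ-< m (2 * T * m) (2 * S * cnt A m)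
      (+-cancelʳ-< m (2 * T * m + m) (2 * S * cnt A m + m) (begin-strict
      2 * T * m + m + m          ≡⟨ double T m m ⟩
      2 * (T * m + m)            ≤⟨ *-monoʳ-≤ 2 (b m) ⟩
      2 * (S * cnt C m + B)      ≡⟨ dist S (cnt C m) B ⟩
      2 * S * cnt C m + 2 * B    <⟨ +-mono-≤-< near B<m ⟩
      2 * S * cnt A m + m + m    ∎)))

  below : ∀ S T → (∃[ B ] ∀ m → S * cnt C m + m ≤ T * m + B) →
          Eventually (λ m → S * cnt A m < T * m)
  below S T (B , b) = both {P = 2 * B <_} go (suc (2 * B) , λ _ p → p)
    (densities-near {A} {C} {r} dA dC (2 * S))
    where
    open ≤-Reasoning
    go : ∀ {m} → 2 * B < m → 2 * S * cnt A m ≤ 2 * S * cnt C m + m → S * cnt A m < T * m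
    go {m} B<m near = halve S (cnt A m) T m (+-cancelʳ-< m (2 * S * cnt A m) (2 * T * m) (begin-strict
      2 * S * cnt A m + m         ≤⟨ +-monoˡ-≤ m near ⟩
      2 * S * cnt C m + m + m     ≡⟨ double S (cnt C m) m ⟩
      2 * (S * cnt C m + m)       ≤⟨ *-monoʳ-≤ 2 (b m) ⟩
      2 * (T * m + B)             ≡⟨ dist T m B ⟩
      2 * T * m + 2 * B           <⟨ +-monoʳ-< (2 * T * m) B<m ⟩
      2 * T * m + m               ∎))

-- The density of C is at least i / 3^M, so it exceeds the thresholds of the
-- columns M, …, M + i - 1, which are therefore empty.  Filling column M + i
-- puts the density above the threshold of that column, leaving it empty puts
-- the density below.
module Diagonal {A C r} (dA : HasDensity A r) (dC : HasDensity C r)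
  (z : ℕ → ℕ) (z≤1 : ∀ n → z n ≤ 1) (settles : Settles C z)
  (M e : ℕ) (blk-M : blk M ≡ pair e M)
  (empty : ∀ j → blk (j + M) ≡ pair e M →
    Eventually (λ m → target (j + M) * m < scale (j + M) * cnt A m) → z (j + M) ≡ 0)
  (full : ∀ j → blk (j + M) ≡ pair e M →
    Eventually (λ m → scale (j + M) * cnt A m < target (j + M) * m) → z (j + M) ≡ 1)
  where

  open Comparison {A} {C} {r} dA dC
  open ≤-Reasoning

  i : ℕ
  i = digits M z

  -- The block is long enough to contain a column for the true value `i`, wherever in the range it
  -- lies.
  i<3^M : i < 3 ^ M
  i<3^M = digits<3^ M z z≤1

  in-block : ∀ {j} → j ≤ i → blk (j + M) ≡ pair e M
  in-block j≤i = blk-block M e blk-M _ (≤-<-trans j≤i i<3^M)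

  target-eq : ∀ {j} → j ≤ i → target (j + M) ≡ suc (2 * (j * 3 ^ j))
  target-eq {j} j≤i rewrite in-block j≤i | snd-pair e M | m+n∸n≡m j M = refl

  scale-eq : ∀ j → scale (j + M) ≡ 2 * (3 ^ j * 3 ^ M)
  scale-eq j = cong (2 *_) (^-distribˡ-+-* 3 j M)

  -- Threshold plus margin is j/3^M + 1/3^(M+j), at most (j + 1)/3^M and so at most i/3^M, which the
  -- density of `C` reaches by the columns before `M` alone.
  empty-before : ∀ j → j < i → z (j + M) ≡ 0
  empty-before j j<i = empty j (in-block (<⇒≤ j<i))
    (above (scale (j + M)) (target (j + M)) (subst₂ Bounded (sym (scale-eq j))
      (sym (target-eq (<⇒≤ j<i))) (2 * 3 ^ j * B , bound)))
    where
    Bounded : ℕ → ℕ → Set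
    Bounded S T = ∃[ B ] ∀ m → T * m + m ≤ S * cnt C m + B
    B : ℕ
    B = proj₁ (lower-bound M C z settles)
    e₁ : ∀ x j m → (1 + 2 * (j * x)) * m + m ≡ 2 * (j * x + 1) * m
    e₁ = solve-∀
    e₂ : ∀ x j m → 2 * (j * x + x) * m ≡ 2 * x * ((1 + j) * m)
    e₂ = solve-∀
    e₃ : ∀ x y c B → 2 * x * (y * c + B) ≡ 2 * (x * y) * c + 2 * x * B
    e₃ = solve-∀
    bound : ∀ m → suc (2 * (j * 3 ^ j)) * m + m ≤
                  2 * (3 ^ j * 3 ^ M) * cnt C m + 2 * 3 ^ j * B
    bound m = begin
      suc (2 * (j * 3 ^ j)) * m + m           ≡⟨ e₁ (3 ^ j) j m ⟩
      2 * (j * 3 ^ j + 1) * m                 ≤⟨ *-monoˡ-≤ m (*-monoʳ-≤ 2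
                                                   (+-monoʳ-≤ (j * 3 ^ j) (m^n>0 3 j))) ⟩
      2 * (j * 3 ^ j + 3 ^ j) * m             ≡⟨ e₂ (3 ^ j) j m ⟩
      2 * 3 ^ j * (suc j * m)                 ≤⟨ *-monoʳ-≤ (2 * 3 ^ j) (*-monoˡ-≤ m j<i) ⟩
      2 * 3 ^ j * (i * m)                     ≤⟨ *-monoʳ-≤ (2 * 3 ^ j)
                                                   (proj₂ (lower-bound M C z settles) m) ⟩
      2 * 3 ^ j * (3 ^ M * cnt C m + B)       ≡⟨ e₃ (3 ^ j) (3 ^ M) (cnt C m) B ⟩
      2 * (3 ^ j * 3 ^ M) * cnt C m + 2 * 3 ^ j * B ∎

  -- Empty columns only multiply the numerator by 3, so the density is now known to lie within
  -- 1/3^(M+j) above i/3^M.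
  digits-block : ∀ j → j ≤ i → digits (j + M) z ≡ i * 3 ^ j
  digits-block zero    _ = sym (*-identityʳ i)
  digits-block (suc j) j<i = begin-equality
    digits (suc (j + M)) z               ≡⟨ digits-suc (j + M) z ⟩
    3 * digits (j + M) z + 2 * z (j + M) ≡⟨ cong₂ (λ d x → 3 * d + 2 * x)
                                              (digits-block j (<⇒≤ j<i)) (empty-before j j<i) ⟩
    3 * (i * 3 ^ j) + 2 * 0              ≡⟨ eq i (3 ^ j) ⟩
    i * 3 ^ suc j                        ∎
    where
    eq : ∀ i x → 3 * (i * x) + 2 * 0 ≡ i * (3 * x)
    eq = solve-∀

  last S T : ℕ
  last = i + M
  S = scale last
  T = target last

  last-digits : digits (suc last) z ≡ 3 * (i * 3 ^ i) + 2 * z last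
  last-digits = trans (digits-suc last z) (cong (λ d → 3 * d + 2 * z last) (digits-block i ≤-refl))

  tripled : ∀ {a m} → 3 * T * m < 3 * S * a → T * m < S * a
  tripled {a} {m} p = *-cancelˡ-< 3 (T * m) (S * a)
    (subst₂ _<_ (*-assoc 3 T m) (*-assoc 3 S a) p)

  tripled′ : ∀ {a m} → 3 * S * a < 3 * T * m → S * a < T * m
  tripled′ {a} {m} p = *-cancelˡ-< 3 (S * a) (T * m)
    (subst₂ _<_ (*-assoc 3 S a) (*-assoc 3 T m) p)

  -- Put x = i · 3^i and measure in units of 1/(3S), half of 1/3^(last+1). The threshold is 6x + 3,
  -- and a full column makes the density at least 6x + 4: just the margin that `above` requires.
  filled-contradiction : z last ≢ 1
  filled-contradiction zn = 1+n≢0 (trans (sym zn) (empty i (in-block ≤-refl)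
    (mapᵉ (λ {m} → tripled {cnt A m} {m}) (above (3 * S) (3 * T)
      (subst Bounded (sym (target-eq ≤-refl)) (2 * B , bound))))))
    where
    Bounded : ℕ → Set
    Bounded T = ∃[ B ] ∀ m → 3 * T * m + m ≤ 3 * S * cnt C m + B
    B : ℕ
    B = proj₁ (lower-bound (suc last) C z settles)
    e₁ : ∀ x m → 3 * (1 + 2 * x) * m + m ≡ 2 * ((3 * x + 2) * m)
    e₁ = solve-∀
    e₂ : ∀ y c B → 2 * (3 * y * c + B) ≡ 3 * (2 * y) * c + 2 * B
    e₂ = solve-∀
    lo : ∀ m → (3 * (i * 3 ^ i) + 2) * m ≤ 3 ^ suc last * cnt C m + B
    lo m = subst (λ p → p * m ≤ 3 ^ suc last * cnt C m + B)
      (trans last-digits (cong (λ x → 3 * (i * 3 ^ i) + 2 * x) zn))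
      (proj₂ (lower-bound (suc last) C z settles) m)
    bound : ∀ m → 3 * suc (2 * (i * 3 ^ i)) * m + m ≤ 3 * S * cnt C m + 2 * B
    bound m = begin
      3 * suc (2 * (i * 3 ^ i)) * m + m   ≡⟨ e₁ (i * 3 ^ i) m ⟩
      2 * ((3 * (i * 3 ^ i) + 2) * m)     ≤⟨ *-monoʳ-≤ 2 (lo m) ⟩
      2 * (3 ^ suc last * cnt C m + B)       ≡⟨ e₂ (3 ^ last) (cnt C m) B ⟩
      3 * (2 * 3 ^ last) * cnt C m + 2 * B   ∎

  -- In the same units an empty column leaves the density at most 2 (3x + 1) = 6x + 2, one below the
  -- threshold 6x + 3.
  empty-contradiction : z last ≢ 0
  empty-contradiction zn = 0≢1+n (trans (sym zn) (full i (in-block ≤-refl)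
    (mapᵉ (λ {m} → tripled′ {cnt A m} {m}) (below (3 * S) (3 * T)
      (subst Bounded (sym (target-eq ≤-refl)) (2 * B , bound))))))
    where
    Bounded : ℕ → Set
    Bounded T = ∃[ B ] ∀ m → 3 * S * cnt C m + m ≤ 3 * T * m + B
    B : ℕ
    B = proj₁ (upper-bound (suc last) C z settles)
    e₁ : ∀ y c m → 3 * (2 * y) * c + m ≡ 2 * (3 * y * c) + m
    e₁ = solve-∀
    e₂ : ∀ x m B → 2 * ((1 + (3 * x + 0)) * m + B) + m ≡ 3 * (1 + 2 * x) * m + 2 * B
    e₂ = solve-∀
    up : ∀ m → 3 ^ suc last * cnt C m ≤ suc (3 * (i * 3 ^ i) + 0) * m + B
    up m = subst (λ p → 3 ^ suc last * cnt C m ≤ suc p * m + B)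
      (trans last-digits (cong (λ x → 3 * (i * 3 ^ i) + 2 * x) zn))
      (proj₂ (upper-bound (suc last) C z settles) m)
    bound : ∀ m → 3 * S * cnt C m + m ≤ 3 * suc (2 * (i * 3 ^ i)) * m + 2 * B
    bound m = begin
      3 * (2 * 3 ^ last) * cnt C m + m                  ≡⟨ e₁ (3 ^ last) (cnt C m) m ⟩
      2 * (3 ^ suc last * cnt C m) + m                  ≤⟨ +-monoˡ-≤ m (*-monoʳ-≤ 2 (up m)) ⟩
      2 * (suc (3 * (i * 3 ^ i) + 0) * m + B) + m    ≡⟨ e₂ (i * 3 ^ i) m B ⟩
      3 * suc (2 * (i * 3 ^ i)) * m + 2 * B          ∎

  contradiction : ⊥
  contradiction with z last in eq | z≤1 last
  ... | 0 | _ = empty-contradiction eq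
  ... | 1 | _ = filled-contradiction eq
  ... | suc (suc _) | s≤s ()

-- The set `C` and its verification

not-flip : ∀ k {b c} → flip k b ≢ flip k c → b ≢ c
not-flip k p refl = p refl

≢-true : ∀ {b} → b ≢ true → b ≡ false
≢-true {false} _ = refl
≢-true {true}  p = ⊥-elim (p refl)

module Construction (em : ExcludedMiddle 0ℓ) where

  truth : Set → Bool
  truth P = does (em {P})

  truth-yes : ∀ {P} → P → truth P ≡ true
  truth-yes {P} p with em {P}
  ... | yes _ = refl
  ... | no ¬p = ⊥-elim (¬p p)

  truth-no : ∀ {P} → ¬ P → truth P ≡ false
  truth-no {P} ¬p with em {P}
  ... | yes p = ⊥-elim (¬p p)
  ... | no _  = refl

  C : ωSet
  C x = flip (kind (lev x)) (truth (Fires (lev x) x))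

  Infinite : ℕ → Set
  Infinite n = ∀ N → Fires n N

  z : ℕ → ℕ
  z n = bit (flip (kind n) (truth (Infinite n)))

  z≤1 : ∀ n → z n ≤ 1
  z≤1 n = bit≤1 (flip (kind n) (truth (Infinite n)))

  -- `Fires n x` asks for a success beyond `x`, so failure at one `N` is inherited by every larger
  -- `x`.
  ¬infinite : ∀ {n} → ¬ Infinite n → Eventually (λ x → ¬ Fires n x)
  ¬infinite {n} ¬inf with em {∃[ N ] ¬ Fires n N}
  ... | yes (N , ¬f) = N , λ x N≤x → λ (m , x<m , s) → ¬f (m , ≤-<-trans N≤x x<m , s)
  ... | no ¬∃ = ⊥-elim (¬inf fires)
    where
    fires : Infinite n
    fires N with em {Fires n N}
    ... | yes f = f
    ... | no ¬f = ⊥-elim (¬∃ (N , ¬f))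

  -- With infinitely many successes every element of the column fires; otherwise only those below
  -- the last success do.
  settles : Settles C z
  settles n with em {Infinite n}
  ... | yes inf = 0 , λ { x _ refl → cong (bit ∘ flip (kind (lev x))) (truth-yes (inf x)) }
  ... | no ¬inf with ¬infinite ¬inf
  ...   | N , ¬f = N , λ { x N≤x refl → cong (bit ∘ flip (kind (lev x))) (truth-no (¬f x N≤x)) }

  Switch : (ℕ → Bool) → Set
  Switch b = ∃[ s₀ ] ∀ s → b s ≢ b (suc s) → s ≡ s₀

  monotone-switch : ∀ b → (∀ s → b s ≡ true → b (suc s) ≡ true) → Switch b
  monotone-switch b mono with em {∃[ s ] b s ≡ false × b (suc s) ≡ true}
  ... | no ¬∃ = 0 , λ s p → ⊥-elim (¬∃ (s , change s p))
    where
    change : ∀ s → b s ≢ b (suc s) → b s ≡ false × b (suc s) ≡ true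
    change s p with b s in eq | b (suc s) in eq′
    ... | true  | true  = ⊥-elim (p refl)
    ... | false | false = ⊥-elim (p refl)
    ... | false | true  = refl , refl
    ... | true  | false with trans (sym eq′) (mono s eq)
    ...   | ()
  ... | yes (s₀ , f₀ , t₀) = s₀ , unique
    where
    later : ∀ {s t} → s ≤ t → b s ≡ true → b t ≡ true
    later {s} {t} s≤t p = subst (λ t → b t ≡ true) (m∸n+n≡m s≤t) (go (t ∸ s))
      where
      go : ∀ j → b (j + s) ≡ true
      go zero    = p
      go (suc j) = mono (j + s) (go j)
    unique : ∀ s → b s ≢ b (suc s) → s ≡ s₀
    unique s p with <-cmp s s₀
    ... | tri≈ _ eq _ = eq
    ... | tri> _ _ s₀<s = ⊥-elim (p (trans (later s₀<s t₀) (sym (later (m≤n⇒m≤1+n s₀<s) t₀))))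
    ... | tri< s<s₀ _ _ with em {b (suc s) ≡ true}
    ...   | yes q with trans (sym f₀) (later s<s₀ q)
    ...     | ()
    unique s p | tri< s<s₀ _ _ | no ¬q with em {b s ≡ true}
    ... | yes q = ⊥-elim (¬q (mono s q))
    ... | no ¬q′ = ⊥-elim (p (trans (≢-true ¬q′) (sym (≢-true ¬q))))

  stage : ℕ → ℕ → Bool
  stage x s = isPos (fired s (lev x) x s)

  guess-suc : ∀ x s → guess x (suc s) ≡ flip (kind (lev x)) (stage x s)
  guess-suc x s = isPos-flip (kind (lev x)) (fired s (lev x) x s)

  stage-limit : ∀ x → stage x ⟶ truth (Fires (lev x) x)
  stage-limit x with em {Fires (lev x) x}
  ... | no ¬f = 0 , λ s _ → ≢-true (λ p → ¬f (fired-sound s (lev x) x s p))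
  ... | yes (m , x<m , s₀ , p) = suc m ⊔ s₀ , λ s ≤s →
    fired-complete s (lev x) x s x<m (≤-trans (m≤m⊔n (suc m) s₀) ≤s)
      (isPos-mono (test-mono (lev x) m (≤-trans (m≤n⊔m (suc m) s₀) ≤s)) p)

  guess-limit : ∀ x → guess x ⟶ C x
  guess-limit x with stage-limit x
  ... | N , p = suc N , λ { (suc s) (s≤s N≤s) →
    trans (guess-suc x s) (cong (flip (kind (lev x))) (p s N≤s)) }

  guess-changes : ∀ x → AtMost 2 (λ s → guess x s ≢ guess x (suc s))
  guess-changes x with monotone-switch (stage x) (λ s → fired-mono s (lev x) x s)
  -- Stage 0 accounts for leaving the prescribed value `false`. The single switch of `stage x` at
  -- `s₀` appears one stage later in `guess`.
  ... | s₀ , unique = 0 List.∷ suc s₀ List.∷ List.[] , ≤-refl , λ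
    { zero    _ → here refl
    ; (suc s) p → there (here (cong suc (unique s (not-flip (kind (lev x))
        (subst₂ _≢_ (guess-suc x s) (guess-suc x (suc s)) p))))) }

  twoCE : TwoCE C
  twoCE = guess , guess-computable , λ x → refl , guess-limit x , guess-changes x

  eventually-success : ∀ {n} → Eventually (Success n) → Infinite n
  eventually-success {n} (M , p) N = suc (M ⊔ N) , s≤s (m≤n⊔m M N) ,
    p (suc (M ⊔ N)) (m≤n⇒m≤1+n (m≤m⊔n M N))

  eventually-failure : ∀ {n} → Eventually (λ m → ¬ Success n m) → ¬ Infinite n
  eventually-failure (M , p) inf with inf M
  ... | m , M<m , s = p m (<⇒≤ M<m) s

  z-infinite : ∀ {n} → Infinite n → z n ≡ bit (flip (kind n) true)
  z-infinite {n} inf = cong (bit ∘ flip (kind n)) (truth-yes inf)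

  z-finite : ∀ {n} → ¬ Infinite n → z n ≡ bit (flip (kind n) false)
  z-finite {n} ¬inf = cong (bit ∘ flip (kind n)) (truth-no ¬inf)

  kind-blk : ∀ n {k a M} → blk n ≡ pair (pair k a) M → kind n ≡ k
  kind-blk n {k} {a} {M} eq rewrite eq | fst-pair (pair k a) M = fst-pair k a

  prog-blk : ∀ n {k a M} → blk n ≡ pair (pair k a) M → prog n ≡ a
  prog-blk n {k} {a} {M} eq rewrite eq | fst-pair (pair k a) M = snd-pair k a

  module _ {A r} (dA : HasDensity A r) (dC : HasDensity C r) (a : ℕ) where

    -- For a c.e. set success means a frequency above the threshold, so infinitely many successes
    -- must empty the column; kind 1 supplies this negation. In `CoCE-case` success means a
    -- frequency below, and kind 0 copies it unchanged.
    CE-case : Enumerates a A → ∀ M → blk M ≡ pair (pair 1 a) M → ⊥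
    CE-case enum M blk-M =
      Diagonal.contradiction {A} {C} {r} dA dC z z≤1 settles M (pair 1 a) blk-M empty full
      where
      success : ∀ j → blk (j + M) ≡ pair (pair 1 a) M → ∀ m →
                Success (j + M) m ⇔ target (j + M) * m < scale (j + M) * cnt A m
      success j eq = success⇔> (kind-blk (j + M) eq)
        (subst (λ a → Enumerates a A) (sym (prog-blk (j + M) eq)) enum)
      empty : ∀ j → blk (j + M) ≡ pair (pair 1 a) M →
        Eventually (λ m → target (j + M) * m < scale (j + M) * cnt A m) → z (j + M) ≡ 0
      empty j eq above = trans
        (z-infinite (eventually-success
          (mapᵉ (λ {m} → Equivalence.from (success j eq m)) above)))
        (cong (λ k → bit (flip k true)) (kind-blk (j + M) eq))
      full : ∀ j → blk (j + M) ≡ pair (pair 1 a) M →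
        Eventually (λ m → scale (j + M) * cnt A m < target (j + M) * m) → z (j + M) ≡ 1
      full j eq below = trans
        (z-finite (eventually-failure
          (mapᵉ (λ {m} lt s → <-asym lt (Equivalence.to (success j eq m) s)) below)))
        (cong (λ k → bit (flip k false)) (kind-blk (j + M) eq))

    CoCE-case : Enumerates a (∁ A) → ∀ M → blk M ≡ pair (pair 0 a) M → ⊥
    CoCE-case enum M blk-M =
      Diagonal.contradiction {A} {C} {r} dA dC z z≤1 settles M (pair 0 a) blk-M empty full
      where
      success : ∀ j → blk (j + M) ≡ pair (pair 0 a) M → ∀ m →
                Success (j + M) m ⇔ scale (j + M) * cnt A m < target (j + M) * m
      success j eq = success⇔< (kind-blk (j + M) eq)
        (subst (λ a → Enumerates a (∁ A)) (sym (prog-blk (j + M) eq)) enum)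
      empty : ∀ j → blk (j + M) ≡ pair (pair 0 a) M →
        Eventually (λ m → target (j + M) * m < scale (j + M) * cnt A m) → z (j + M) ≡ 0
      empty j eq above = trans
        (z-finite (eventually-failure
          (mapᵉ (λ {m} lt s → <-asym lt (Equivalence.to (success j eq m) s)) above)))
        (cong (λ k → bit (flip k false)) (kind-blk (j + M) eq))
      full : ∀ j → blk (j + M) ≡ pair (pair 0 a) M →
        Eventually (λ m → scale (j + M) * cnt A m < target (j + M) * m) → z (j + M) ≡ 1
      full j eq below = trans
        (z-infinite (eventually-success
          (mapᵉ (λ {m} → Equivalence.from (success j eq m)) below)))
        (cong (λ k → bit (flip k true)) (kind-blk (j + M) eq))

  not-CE-density : ∀ {r} → HasDensity C r → ∀ A → CE A → ¬ HasDensity A r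
  not-CE-density {r} dC A ce dA = uncurry (CE-case {A} {r} dA dC a enum) (blk-start (pair 1 a))
    where
    a : ℕ
    a = proj₁ (CE-index ce)
    enum : Enumerates a A
    enum = proj₂ (CE-index ce)

  not-CoCE-density : ∀ {r} → HasDensity C r → ∀ A → CoCE A → ¬ HasDensity A r
  not-CoCE-density {r} dC A co dA = uncurry (CoCE-case {A} {r} dA dC a enum) (blk-start (pair 0 a))
    where
    a : ℕ
    a = proj₁ (CE-index co)
    enum : Enumerates a (∁ A)
    enum = proj₂ (CE-index co)

corollary3p7 : ExcludedMiddle 0ℓ →
    ∃[ C ] TwoCE C × ∃[ r ] HasDensity C r
    × (∀ A → CE A → ¬ HasDensity A r)
    × (∀ A → CoCE A → ¬ HasDensity A r)
corollary3p7 em = C , twoCE , r , dC , not-CE-density {r} dC , not-CoCE-density {r} dC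
  where
  open Construction em
  r : ℝ
  r = proj₁ (density C (cauchy-cnt C z settles))
  dC : HasDensity C r
  dC = proj₂ (density C (cauchy-cnt C z settles))
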